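{- Let $n\ge 10$ and $I\in\mathcal{I}_n$. Then the complex $\Delta(I)$ is a centrally symmetric combinatorial $3$-sphere on the vertex set $V_{n+1}$ that is cs-$2$-neighborly with respect to $V_{n+1}$.
   Context: Simplicial complexes are finite abstract simplicial complexes; $\overline{A}$ is the simplex of all subsets of a finite set $A$. $V_m=\{\pm1,\dots,\pm m\}$; $-\sigma=\{ -v:v\in\sigma\}$, $-\Gamma=\{ -\sigma:\sigma\in\Gamma\}$. The join is $\Gamma*\Gamma'=\{\sigma\cup\tau\}$, $\Gamma*v:=\Gamma*\overline{\{v\}}$; a path/cycle $(v_1,\dots,v_m)$ is the 1-dimensional complex with edges $\{v_j,v_{j+1}\}$. $\partial C^*_m$ is the complex of all subsets of $V_m$ with no pair $\{j,-j\}$. For pure $\Delta$ and pure full-dimensional subcomplex $\Gamma$, $\Delta\setminus\Gamma$ is generated by facets of $\Delta$ not in $\Gamma$; $\partial B$ is the boundary of a combinatorial ball $B$. Recursive definition: $\Delta^1_n=(1,\dots,n,-1,\dots,-n,1)$; $\Delta^d_{d+1}=\partial C^*_{d+1}$; $B^{d,j}_n=\emptyset$ for $j<0$; $B^{1,0}_n=\overline{\{ -1,n\}}$; $B^{2k-1,k}_n=\Delta^{2k-1}_n\setminus B^{2k-1,k-1}_n$ ($k\ge1$, $n\ge 2k$); $B^{d,i}_n=(B^{d-1,i}_{n-1}*n)\cup((-B^{d-1,i-1}_{n-1})*(-n))$ ($d\ge2$, $n\ge d+1$, $i\le\lfloor d/2\rfloor$); $\Delta^d_{n+1}$ is obtained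 from $\Delta^d_n$ by replacing $B=B^{d,\lceil d/2\rceil-1}_n$ with $\partial B*(n+1)$ and $-B$ with $\partial(-B)*(-n-1)$ (known to be well defined; $\Delta^3_n$ is a combinatorial 3-sphere on $V_n$). Let $\mathcal{I}_n$ be the collection of all sets $I=\{i_1<\dots<i_p\}\subseteq\{3,4,\dots,n-6\}$ ($p\ge0$) such that $i_2-i_1>1$ if $p\ge2$; set $i_{p+1}:=n-2$. Let $B(I)$ be the pure 3-dimensional complex whose facets are: $\{1,2,i,i+2\}$ for $3\le i\le n-2$; $\{1,2,n-1,n\}$; $\{1,-n+2,n-1,n\}$, $\{1,-n+2,-n+1,n\}$, $\{1,-n+2,-n+1,-n\}$; $\{ -n+m+1,-n+m,n-1,n\}$ for $2\le m\le i_1$ (if $p=0$, for $2\le m\le n-2$); and for each $1\le j\le p$: $\{1,-n+i_j+2,n-i_j-1,n-i_j+1\}$ and $\{ -n+m+1,-n+m,n-i_j-1,n-i_j+1\}$ for $i_j+2\le m\le i_{j+1}$. Let $\partial B(I)$ denote the complex generated by the 2-faces of $B(I)$ contained in exactly one facet of $B(I)$. Define $\Delta(I)$ as the complex obtained from $\Delta^3_n$ by replacing $B(I)$ with $\partial B(I)*(n+1)$ and $-B(I)$ with $\partial(-B(I))*(-n-1)$, i.e. its facets are the facets of $\Delta^3_n$ not in $B(I)\cup -B(I)$, together with $\tau\cup\{n+1\}$ and $-\tau\cup\{ -n-1\}$ for facets $\tau$ of $\partial B(I)$. A complex is centrally symmetric if it is closed under $\sigma\mapsto -\sigma$; it is cs-$i$-neighborly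 w.r.t. $V_m$ if every subset of $V_m$ of size $\le i$ with no pair $\{v,-v\}$ is a face. -}

module Defs where

open import Data.Bool using (Bool; true; false; not; _∧_; if_then_else_)
open import Data.Nat as ℕ using (ℕ; zero; suc; _+_; _∸_; _≤_; _<_; _≤ᵇ_; _≡ᵇ_)
open import Data.Integer as ℤ using (ℤ)
open import Data.Integer using (+_)
open import Data.List using (List; []; _∷_; _++_; [_]; map; filterᵇ; length; concatMap; applyUpTo)
open import Data.Bool.ListAction using (any; all)
open import Data.List.Relation.Unary.Any using (Any)
open import Data.List.Relation.Unary.All using (All)
open import Data.List.Relation.Unary.AllPairs using (AllPairs)
open import Data.List.Relation.Unary.Unique.Propositional using (Unique)
open import Data.List.Membership.Propositional using (_∈_; _∉_)
open import Data.List.Relation.Binary.Subset.Propositional using (_⊆_)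
open import Data.Product using (_×_; ∃; ∃₂; Σ)
open import Data.Sum using (_⊎_)
open import Data.Unit using (⊤)
open import Relation.Nullary using (does; ¬_)
open import Relation.Binary.PropositionalEquality using (_≡_; _≢_)
open import Relation.Binary.Construct.Closure.Equivalence using (EqClosure)
open import Function.Bundles using (_⇔_)

-- Simplices are finite sets of (nonzero) integer vertices, represented
-- by lists (order / repetitions irrelevant).  A complex is given by a
-- list of generating simplices (facets); its faces are all subsets.

Simplex : Set
Simplex = List ℤ

FacetList : Set
FacetList = List Simplex

_≋_ : Simplex → Simplex → Set
σ ≋ τ = σ ⊆ τ × τ ⊆ σ

Face : FacetList → Simplex → Set
Face K σ = Any (σ ⊆_) K

_∈ᵇ_ : ℤ → Simplex → Bool
x ∈ᵇ σ = any (λ y → does (x ℤ.≟ y)) σ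

_⊆ᵇ_ : Simplex → Simplex → Bool
σ ⊆ᵇ τ = all (_∈ᵇ τ) σ

_≋ᵇ_ : Simplex → Simplex → Bool
σ ≋ᵇ τ = (σ ⊆ᵇ τ) ∧ (τ ⊆ᵇ σ)

_∈Fᵇ_ : Simplex → FacetList → Bool
σ ∈Fᵇ F = any (σ ≋ᵇ_) F

range : ℕ → ℕ → List ℕ
range a b = applyUpTo (λ k → a ℕ.+ k) (suc b ∸ a)

negS : Simplex → Simplex
negS = map (λ x → ℤ.- x)

negF : FacetList → FacetList
negF = map negS

joinV : FacetList → ℤ → FacetList
joinV F v = map (v ∷_) F

diff : FacetList → FacetList → FacetList
diff F G = filterB F
  where filterB = filterᵇ (λ σ → not (σ ∈Fᵇ G))

dropEach : Simplex → List Simplex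
dropEach [] = []
dropEach (x ∷ xs) = xs ∷ map (x ∷_) (dropEach xs)

bd : FacetList → FacetList
bd B = concatMap (λ τ → filterᵇ (λ ρ → length (filterᵇ (ρ ⊆ᵇ_) B) ≡ᵇ 1) (dropEach τ)) B

replace : FacetList → FacetList → ℤ → FacetList
replace D Bf v = diff D (Bf ++ negF Bf) ++ joinV (bd Bf) v ++ joinV (bd (negF Bf)) (ℤ.- v)

pathEdges : List ℤ → FacetList
pathEdges (a ∷ b ∷ rest) = (a ∷ b ∷ []) ∷ pathEdges (b ∷ rest)
pathEdges _ = []

cycle : ℕ → FacetList
cycle n = pathEdges (map (λ k → + k) (range 1 n) ++ map (λ k → ℤ.- (+ k)) (range 1 n) ++ [ + 1 ])

crossC : ℕ → FacetList
crossC zero = [] ∷ []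
crossC (suc m) = concatMap (λ σ → ((+ suc m) ∷ σ) ∷ ((ℤ.- (+ suc m)) ∷ σ) ∷ []) (crossC m)

ceilHalf : ℕ → ℕ
ceilHalf d = suc d ℕ./ 2

floorHalf : ℕ → ℕ
floorHalf d = d ℕ./ 2

-- Values outside the range of definition in the paper (n < d+1 etc.)
-- are junk and never used.
mutual
  Δ : ℕ → ℕ → FacetList
  Δ zero n = []
  Δ (suc zero) n = cycle n
  Δ (suc (suc d')) zero = []
  Δ (suc (suc d')) (suc m) =
    if suc m ≤ᵇ suc (suc (suc d'))
    then crossC (suc (suc (suc d')))
    else replace (Δ (suc (suc d')) m) (B (suc (suc d')) (ceilHalf (suc (suc d')) ∸ 1) m) (+ suc m)

  -- B d i n = B^{d,i}_n  (i ≥ 0; B^{d,-1} = ∅ is built in)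
  B : ℕ → ℕ → ℕ → FacetList
  B zero i n = []
  B (suc zero) zero n = ((ℤ.- (+ 1)) ∷ (+ n) ∷ []) ∷ []
  B (suc zero) (suc zero) n = diff (Δ (suc zero) n) (B (suc zero) zero n)
  B (suc zero) (suc (suc i)) n = []
  B (suc (suc d')) i zero = []
  B (suc (suc d')) zero (suc m) = joinV (B (suc d') zero m) (+ suc m)
  B (suc (suc d')) (suc i') (suc m) =
    if (2 ℕ.* suc i') ≡ᵇ suc (suc (suc d'))
    then diff (Δ (suc (suc d')) (suc m)) (B (suc (suc d')) i' (suc m))
    else (if suc i' ≤ᵇ floorHalf (suc (suc d'))
          then joinV (B (suc d') (suc i') m) (+ suc m)
               ++ joinV (negF (B (suc d') i' m)) (ℤ.- (+ suc m))
          else [])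

Gap : List ℕ → Set
Gap (a ∷ b ∷ _) = suc a < b
Gap _ = ⊤

InCalI : ℕ → List ℕ → Set
InCalI n I = All (λ i → 3 ≤ i × i ≤ n ∸ 6) I × AllPairs _<_ I × Gap I

private
  p : ℕ → ℤ
  p k = + k
  r : ℕ → ℕ → ℤ
  r n m = (+ m) ℤ.- (+ n)

firstOr : ℕ → List ℕ → ℕ
firstOr d [] = d
firstOr d (i ∷ _) = i

-- facets for j = 1..p, given the list i₁,…,i_p,i_{p+1}
blocks : ℕ → List ℕ → FacetList
blocks n (a ∷ b ∷ rest) =
  (p 1 ∷ r n (a + 2) ∷ p (n ∸ a ∸ 1) ∷ p (n ∸ a + 1) ∷ [])
  ∷ map (λ m → r n (m + 1) ∷ r n m ∷ p (n ∸ a ∸ 1) ∷ p (n ∸ a + 1) ∷ []) (range (a + 2) b)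
  ++ blocks n (b ∷ rest)
blocks n _ = []

BI : ℕ → List ℕ → FacetList
BI n I =
  map (λ i → p 1 ∷ p 2 ∷ p i ∷ p (i + 2) ∷ []) (range 3 (n ∸ 2))
  ++ (p 1 ∷ p 2 ∷ p (n ∸ 1) ∷ p n ∷ [])
  ∷ (p 1 ∷ r n 2 ∷ p (n ∸ 1) ∷ p n ∷ [])
  ∷ (p 1 ∷ r n 2 ∷ r n 1 ∷ p n ∷ [])
  ∷ (p 1 ∷ r n 2 ∷ r n 1 ∷ ℤ.- (+ n) ∷ [])
  ∷ map (λ m → r n (m + 1) ∷ r n m ∷ p (n ∸ 1) ∷ p n ∷ []) (range 2 (firstOr (n ∸ 2) I))
  ++ blocks n (I ++ [ n ∸ 2 ])

ΔI : ℕ → List ℕ → FacetList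
ΔI n I = replace (Δ 3 n) (BI n I) (+ suc n)

CentrallySymmetric : FacetList → Set
CentrallySymmetric K = ∀ σ → Face K σ → Face K (negS σ)

InV : ℕ → ℤ → Set
InV m v = ∃ λ k → 1 ≤ k × k ≤ m × (v ≡ + k ⊎ v ≡ ℤ.- (+ k))

VertexSetIs : FacetList → ℕ → Set
VertexSetIs K m = ∀ v → Face K [ v ] ⇔ InV m v

CsNeighborly : ℕ → ℕ → FacetList → Set
CsNeighborly i m K =
  ∀ σ → Unique σ → All (InV m) σ → length σ ≤ i →
  (∀ v → v ∈ σ → ¬ (ℤ.- v ∈ σ)) → Face K σ

-- faces of the stellar subdivision of K at the face σ with new vertex v:
-- (K minus star of σ) ∪ (v * ∂σ * lk σ)
StellarSd : FacetList → Simplex → ℤ → Simplex → Set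
StellarSd K σ v ρ =
  (Face K ρ × ¬ (σ ⊆ ρ))
  ⊎ ∃₂ λ α β → α ⊆ σ × ¬ (σ ⊆ α) × All (_∉ σ) β × Face K (σ ++ β) × ρ ≋ (v ∷ α ++ β)

data Step (K L : FacetList) : Set where
  subdiv : (σ : Simplex) → σ ≢ [] → Face K σ → (v : ℤ) → ¬ Face K [ v ] →
           (∀ ρ → Face L ρ ⇔ StellarSd K σ v ρ) → Step K L
  iso    : (f : ℤ → ℤ) → (∀ x y → f x ≡ f y → x ≡ y) →
           (∀ ρ → Face L ρ ⇔ (∃ λ τ → Face K τ × ρ ≋ map f τ)) → Step K L

-- combinatorial (PL) equivalence: stellar subdivisions, welds, isomorphisms
StellarEquivalent : FacetList → FacetList → Set
StellarEquivalent = EqClosure Step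

simplexBoundary : ℕ → FacetList
simplexBoundary d = dropEach (map (λ k → + k) (range 0 (suc d)))

CombinatorialSphere : ℕ → FacetList → Set
CombinatorialSphere d K = StellarEquivalent K (simplexBoundary d)

{-# OPTIONS --safe #-}

-- Both Δ^3_{n+1} and Δ(I) arise from Δ^3_n by exchanging antipodal balls ±B for
-- cones over their boundaries, and in both cases B is stacked: its tetrahedra can
-- be ordered so that each consists of a new vertex and a triangle of an earlier
-- one.  Coning over the boundary of such a ball is a sequence of bistellar flips:
-- the first tetrahedron is starred with the apex v, and a further tetrahedron,
-- with new vertex x attached along the triangle t, trades t for the edge {v, x}.
-- A flip preserves the stellar equivalence class, since both sides have a common
-- stellar subdivision, the property that a triangle lies in at most two
-- tetrahedra, and all faces with at most two vertices.  As v is joined to every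
-- vertex of B, 2-neighborliness is inherited.  The spheres Δ^3_n are reached in
-- this way from the cross-polytope, itself obtained from the boundary of a simplex
-- by four stellar subdivisions.

module Submission where

open import Defs
open import Data.Bool using (true; false; not; T; T?)
open import Data.Bool.ListAction using (all)
open import Data.Bool.Properties using (T-∧; T-≡)
open import Data.Empty using (⊥; ⊥-elim)
open import Data.Unit using (tt)
open import Data.Integer as ℤ using (ℤ; +_; -[1+_])
import Data.Integer.Properties as ℤₚ
open import Data.Nat as ℕ using (ℕ; zero; suc; _+_; _∸_; _≤_; _<_; z≤n; s≤s; _≡ᵇ_)
import Data.Nat.Properties as ℕₚ
open import Data.List using (List; []; _∷_; _++_; [_]; map; filter; filterᵇ; length; concatMap; concat; applyUpTo; applyDownFrom; _ʳ++_)
import Data.List.Properties as Listₚ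
open import Data.List.Relation.Unary.Any using (Any; here; there)
import Data.List.Relation.Unary.Any as Any
import Data.List.Relation.Unary.Any.Properties as Anyₚ
open import Data.List.Relation.Unary.All using (All; []; _∷_)
import Data.List.Relation.Unary.All as All
import Data.List.Relation.Unary.All.Properties as Allₚ
open import Data.List.Relation.Unary.AllPairs using (AllPairs; []; _∷_)
import Data.List.Relation.Unary.AllPairs as AllPairs
import Data.List.Relation.Unary.AllPairs.Properties as AllPairsₚ
open import Data.List.Relation.Unary.Unique.Propositional using (Unique)
import Data.List.Relation.Unary.Unique.Propositional.Properties as Uniqueₚ
open import Data.List.Membership.Propositional using (_∈_; _∉_; find; lose)
open import Data.List.Membership.Propositional.Properties
open import Data.List.Membership.DecPropositional ℤ._≟_ using (_∈?_)
open import Data.List.Relation.Binary.Subset.DecPropositional ℤ._≟_ using (_⊆_; _⊆?_)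
open import Data.List.Relation.Binary.Subset.Propositional.Properties
  using (∷⁺ʳ) renaming (map⁺ to ⊆-map⁺; ∈-∷⁺ʳ to ∷-⊆)
open import Data.List.Relation.Binary.Permutation.Propositional using (_↭_; ↭-sym; ↭-trans; prep)
import Data.List.Relation.Binary.Permutation.Propositional as Perm
import Data.List.Relation.Binary.Permutation.Propositional.Properties as Permₚ
open import Data.Product using (_×_; _,_; ∃; ∃₂; proj₁; proj₂)
open import Data.Sum using (_⊎_; inj₁; inj₂; [_,_]′)
open import Function using (_∘_; id; case_of_)
open import Function.Bundles using (_⇔_; mk⇔; Equivalence)
open import Relation.Nullary using (¬_; Dec; yes; no; does; contradiction)
open import Relation.Nullary.Decidable using (¬?; True; False; toWitness; toWitnessFalse; _×-dec_; _⊎-dec_)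
open import Data.List.Relation.Unary.Unique.DecPropositional ℤ._≟_ using (unique?)
open import Relation.Binary.Construct.Closure.ReflexiveTransitive using (ε; _◅_; _◅◅_)
open import Relation.Binary.Construct.Closure.Symmetric using (fwd; bwd)
import Relation.Binary.Construct.Closure.Equivalence as Eq
open import Relation.Binary.PropositionalEquality using (_≡_; _≢_; refl; sym; trans; cong; cong₂; subst; subst₂)

-- A flip at a triangle t requires the link of t to consist of two points. One is v, because t is on
-- the boundary of the part already coned; that the other is x follows from the bound of two
-- tetrahedra per triangle. This bound is the only manifold property carried along: it identifies
-- the link, and it passes through a flip by counting vertices. The edge {v, x} is absent beforehand
-- because v is joined only to vertices of tetrahedra already coned. `replace` exchanges B and -B at
-- once, while flips treat one ball at a time. The second ball must survive the first coning, so B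
-- and -B may share no tetrahedron; the signs of the vertices show this. The intermediate complex is
-- not symmetric, so symmetry is read off from a description of the final faces. Finally B(I) must
-- lie in Δ^3_n. Two families of facets are tracked for this: the tetrahedra of B^{3,1}, which at
-- each stage are cones over boundary triangles of the previous balls, and facets that arise at some
-- stage and are never removed.

∈ᵇ⇒∈ : ∀ x σ → T (x ∈ᵇ σ) → x ∈ σ
∈ᵇ⇒∈ x σ p = Any.map (λ {y} → ≟-sound y) (Anyₚ.any⁻ (λ y → does (x ℤ.≟ y)) σ p)
  where
  ≟-sound : ∀ y → T (does (x ℤ.≟ y)) → x ≡ y
  ≟-sound y t with x ℤ.≟ y
  ... | yes e = e

∈⇒∈ᵇ : ∀ {x σ} → x ∈ σ → T (x ∈ᵇ σ)
∈⇒∈ᵇ {x} p = Anyₚ.any⁺ (λ y → does (x ℤ.≟ y)) (Any.map (λ {y} → ≟-complete y) p)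
  where
  ≟-complete : ∀ y → x ≡ y → T (does (x ℤ.≟ y))
  ≟-complete y e with x ℤ.≟ y
  ... | yes _ = tt
  ... | no ne = ne e

⊆ᵇ⇒⊆ : ∀ σ τ → T (σ ⊆ᵇ τ) → σ ⊆ τ
⊆ᵇ⇒⊆ σ τ p x∈ = ∈ᵇ⇒∈ _ τ (All.lookup (Allₚ.all⁺ (_∈ᵇ τ) σ p) x∈)

⊆⇒⊆ᵇ : ∀ {σ τ} → σ ⊆ τ → T (σ ⊆ᵇ τ)
⊆⇒⊆ᵇ {σ} {τ} p = Allₚ.all⁻ (_∈ᵇ τ) (All.tabulate λ x∈ → ∈⇒∈ᵇ (p x∈))

≋ᵇ⇒≋ : ∀ σ τ → T (σ ≋ᵇ τ) → σ ≋ τ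
≋ᵇ⇒≋ σ τ t with Equivalence.to T-∧ t
... | u , v = ⊆ᵇ⇒⊆ σ τ u , ⊆ᵇ⇒⊆ τ σ v

≋⇒≋ᵇ : ∀ {σ τ} → σ ≋ τ → T (σ ≋ᵇ τ)
≋⇒≋ᵇ (u , v) = Equivalence.from T-∧ (⊆⇒⊆ᵇ u , ⊆⇒⊆ᵇ v)

∈Fᵇ⇒Any : ∀ σ F → T (σ ∈Fᵇ F) → Any (σ ≋_) F
∈Fᵇ⇒Any σ F p = Any.map (λ {τ} → ≋ᵇ⇒≋ σ τ) (Anyₚ.any⁻ (σ ≋ᵇ_) F p)

Any⇒∈Fᵇ : ∀ {σ F} → Any (σ ≋_) F → T (σ ∈Fᵇ F)
Any⇒∈Fᵇ {σ} p = Anyₚ.any⁺ (σ ≋ᵇ_) (Any.map ≋⇒≋ᵇ p)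

≋-refl : ∀ {σ} → σ ≋ σ
≋-refl = id , id

≋-sym : ∀ {σ τ} → σ ≋ τ → τ ≋ σ
≋-sym (p , q) = q , p

≋-trans : ∀ {σ τ ρ} → σ ≋ τ → τ ≋ ρ → σ ≋ ρ
≋-trans (p , q) (p' , q') = p' ∘ p , q ∘ q'

≋? : ∀ σ F → Dec (Any (σ ≋_) F)
≋? σ F with σ ∈Fᵇ F in eq
... | true = yes (∈Fᵇ⇒Any σ F (Equivalence.from T-≡ eq))
... | false = no λ a → subst T eq (Any⇒∈Fᵇ a)

∈-diff⁺ : ∀ {σ F G} → σ ∈ F → ¬ Any (σ ≋_) G → σ ∈ diff F G
∈-diff⁺ {σ} {F} {G} p q = ∈-filter⁺ _ p (keep (σ ∈Fᵇ G) refl)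
  where
  keep : ∀ b → σ ∈Fᵇ G ≡ b → T (not (σ ∈Fᵇ G))
  keep true e = ⊥-elim (q (∈Fᵇ⇒Any σ G (Equivalence.from T-≡ e)))
  keep false e = subst (T ∘ not) (sym e) tt

∈-diff⁻ : ∀ {σ} F G → σ ∈ diff F G → σ ∈ F × ¬ Any (σ ≋_) G
∈-diff⁻ {σ} F G p with ∈-filter⁻ (λ σ → T? (not (σ ∈Fᵇ G))) {xs = F} p
... | p₁ , p₂ = p₁ , λ a → T-absurd (σ ∈Fᵇ G) p₂ (Any⇒∈Fᵇ a)
  where
  T-absurd : ∀ b → T (not b) → T b → ⊥
  T-absurd false _ ()

-- Cardinalities of simplices.

del : ℤ → Simplex → Simplex
del x = filter (λ y → ¬? (y ℤ.≟ x))

length-del : ∀ {x ys} → x ∈ ys → length (del x ys) < length ys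
length-del x∈ = Listₚ.filter-notAll _ _ (Any.map (λ e ne → ne (sym e)) x∈)

unique-⊆-length : ∀ {xs ys} → Unique xs → xs ⊆ ys → length xs ≤ length ys
unique-⊆-length [] _ = z≤n
unique-⊆-length {x ∷ xs} {ys} (x∉ ∷ u) s =
  ℕₚ.≤-trans (s≤s (unique-⊆-length u λ {y} y∈ →
    ∈-filter⁺ _ (s (there y∈)) λ e → All.lookup x∉ y∈ (sym e)))
  (length-del (s (here refl)))

∉⇒unique-∷ : ∀ {x : ℤ} {xs} → x ∉ xs → Unique xs → Unique (x ∷ xs)
∉⇒unique-∷ x∉ u = All.tabulate (λ y∈ e → x∉ (subst (_∈ _) (sym e) y∈)) ∷ u

unique-⊆-full : ∀ {xs ys} → Unique xs → xs ⊆ ys → length ys ≤ length xs → ys ⊆ xs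
unique-⊆-full {xs} {ys} u s l {y} y∈ with y ∈? xs
... | yes p = p
... | no y∉ = contradiction
  (ℕₚ.≤-trans (unique-⊆-length (∉⇒unique-∷ y∉ u) (∷-⊆ y∈ s)) l) (ℕₚ.<⇒≱ ℕₚ.≤-refl)

⊈⇒∃ : ∀ {xs ys : Simplex} → ¬ (xs ⊆ ys) → ∃ λ y → y ∈ xs × y ∉ ys
⊈⇒∃ {xs} {ys} n = find (Allₚ.¬All⇒Any¬ (_∈? ys) xs λ a → n (All.lookup a))

head-∉ : ∀ {x : ℤ} {xs} → Unique (x ∷ xs) → x ∉ xs
head-∉ (x∉ ∷ _) x∈ = All.lookup x∉ x∈ refl

tail-unique : ∀ {x : ℤ} {xs} → Unique (x ∷ xs) → Unique xs
tail-unique (_ ∷ u) = u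

∈-dropEach⁻ : ∀ {ρ τ} → Unique τ → ρ ∈ dropEach τ →
  ∃ λ y → Unique (y ∷ ρ) × τ ≋ (y ∷ ρ) × length τ ≡ suc (length ρ)
∈-dropEach⁻ {τ = x ∷ xs} u (here refl) = x , u , ≋-refl , refl
∈-dropEach⁻ {τ = x ∷ xs} (x∉ ∷ u) (there p) with ∈-map⁻ (x ∷_) p
... | ρ , q , refl with ∈-dropEach⁻ u q
... | y , (y∉ ∷ uρ) , (s , t) , l =
  y , (All.tabulate yfresh ∷ All.tabulate (λ z∈ → All.lookup x∉ (t (there z∈))) ∷ uρ) ,
  (fwd⊆ , bwd⊆) , cong suc l
  where
  yfresh : ∀ {z} → z ∈ x ∷ ρ → y ≢ z
  yfresh (here refl) e = All.lookup x∉ (t (here refl)) (sym e)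
  yfresh (there z∈) e = All.lookup y∉ z∈ e
  fwd⊆ : x ∷ xs ⊆ y ∷ x ∷ ρ
  fwd⊆ (here e) = there (here e)
  fwd⊆ (there z∈) with s z∈
  ... | here e = here e
  ... | there w = there (there w)
  bwd⊆ : y ∷ x ∷ ρ ⊆ x ∷ xs
  bwd⊆ (here e) = there (t (here e))
  bwd⊆ (there (here e)) = here e
  bwd⊆ (there (there w)) = there (t (there w))

∈-dropEach⁺ : ∀ {y τ} → y ∈ τ → ∃ λ ρ → ρ ∈ dropEach τ × ρ ⊆ τ × τ ⊆ (y ∷ ρ)
∈-dropEach⁺ {τ = x ∷ xs} (here refl) = xs , here refl , there , id
∈-dropEach⁺ {y} {x ∷ xs} (there p) with ∈-dropEach⁺ p
... | ρ , q , s , t = x ∷ ρ , there (∈-map⁺ (x ∷_) q) , ∷⁺ʳ x s , sub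
  where
  sub : x ∷ xs ⊆ y ∷ x ∷ ρ
  sub (here e) = there (here e)
  sub (there z∈) with t z∈
  ... | here e = here e
  ... | there w = there (there w)

-- Tetrahedra, triangles and boundaries

Tet Tri : Simplex → Set
Tet τ = Unique τ × length τ ≡ 4
Tri τ = Unique τ × length τ ≡ 3

tet-⊆ : ∀ {σ τ} → Tet σ → Tet τ → σ ⊆ τ → σ ≋ τ
tet-⊆ (u , l) (_ , l') s = s , unique-⊆-full u s (ℕₚ.≤-reflexive (trans l' (sym l)))

tri-⊆ : ∀ {σ τ} → Tri σ → Tri τ → σ ⊆ τ → σ ≋ τ
tri-⊆ (u , l) (_ , l') s = s , unique-⊆-full u s (ℕₚ.≤-reflexive (trans l' (sym l)))

-- Boundary membership up to reordering and without counting, so that it transports along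
-- permutations of S and along negation.
Bd : FacetList → Simplex → Set
Bd S t = ∃ λ F → F ∈ S × t ⊆ F × (∀ {G} → G ∈ S → t ⊆ G → G ≋ F)

Distinct : FacetList → Set
Distinct = AllPairs (λ F G → ¬ (F ≋ G))

containing : FacetList → Simplex → FacetList
containing B ρ = filterᵇ (ρ ⊆ᵇ_) B

∈-containing⁺ : ∀ {B ρ F} → F ∈ B → ρ ⊆ F → F ∈ containing B ρ
∈-containing⁺ F∈ s = ∈-filter⁺ _ F∈ (⊆⇒⊆ᵇ s)

∈-containing⁻ : ∀ B ρ {F} → F ∈ containing B ρ → F ∈ B × ρ ⊆ F
∈-containing⁻ B ρ {F} p = let q , r = ∈-filter⁻ (λ τ → T? (ρ ⊆ᵇ τ)) {xs = B} p in q , ⊆ᵇ⇒⊆ ρ F r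

length-one : ∀ (L : FacetList) → length L ≡ 1 → ∀ {F G} → F ∈ L → G ∈ L → F ≡ G
length-one (x ∷ []) _ (here refl) (here refl) = refl

bd-sound : ∀ {B} → All Tet B → ∀ {t} → t ∈ bd B → Tri t × Bd B t
bd-sound {B} tets {t} t∈
  with find (∈-concatMap⁻ _ {xs = B} t∈)
... | τ , τ∈ , t∈' with ∈-filter⁻ (λ ρ → T? (length (containing B ρ) ≡ᵇ 1)) {xs = dropEach τ} t∈'
... | t∈τ , one with All.lookup tets τ∈
... | uτ , lτ with ∈-dropEach⁻ uτ t∈τ
... | y , uyt , (_ , s) , l = (tail-unique uyt , ℕₚ.suc-injective (trans (sym l) lτ)) ,
  τ , τ∈ , s ∘ there , unique
  where
  unique : ∀ {G} → G ∈ B → t ⊆ G → G ≋ τ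
  unique G∈ tG with length-one _ (ℕₚ.≡ᵇ⇒≡ (length (containing B t)) 1 one)
    (∈-containing⁺ {B} G∈ tG) (∈-containing⁺ {B} τ∈ (s ∘ there))
  ... | refl = ≋-refl

length-distinct : ∀ {F L} → Distinct L → F ∈ L → (∀ {G} → G ∈ L → G ≋ F) → length L ≡ 1
length-distinct {L = x ∷ []} _ _ _ = refl
length-distinct {L = x ∷ y ∷ L} ((n ∷ _) ∷ _) _ all =
  ⊥-elim (n (≋-trans (all (here refl)) (≋-sym (all (there (here refl))))))

tri-⊂-tet : ∀ {t F} → Tri t → Tet F → t ⊆ F → ∃ λ y → y ∈ F × y ∉ t
tri-⊂-tet (_ , lt) (uF , lF) _ = ⊈⇒∃ λ s → case subst₂ _≤_ lF lt (unique-⊆-length uF s) of λ where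
  (s≤s (s≤s (s≤s ())))

-- `bd` keeps the vertex order inherited from the tetrahedron, so only a reordering t' of t is
-- found. It counts list entries, and `Distinct` turns uniqueness up to `≋` into a count of one.
bd-complete : ∀ {B} → Distinct B → All Tet B → ∀ {t} → Tri t → Bd B t → ∃ λ t' → t' ∈ bd B × t' ≋ t
bd-complete {B} d tets {t} (ut , lt) (F , F∈ , tF , uniq) with All.lookup tets F∈
... | uF , lF with tri-⊂-tet (ut , lt) (uF , lF) tF
... | y , y∈F , y∉t with ∈-dropEach⁺ y∈F
... | t' , t'∈ , t'F , Ft' = t' , ∈-concatMap⁺ _ (lose F∈ (∈-filter⁺ _ t'∈ (ℕₚ.≡⇒≡ᵇ _ 1 one))) , (t'⊆t , t⊆t')
  where
  t⊆t' : t ⊆ t'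
  t⊆t' x∈ with Ft' (tF x∈)
  ... | here e = ⊥-elim (y∉t (subst (_∈ t) e x∈))
  ... | there q = q
  lt' : length t' ≡ 3
  lt' = let _ , _ , _ , l = ∈-dropEach⁻ uF t'∈ in ℕₚ.suc-injective (trans (sym l) lF)
  t'⊆t : t' ⊆ t
  t'⊆t = unique-⊆-full ut t⊆t' (ℕₚ.≤-reflexive (trans lt' (sym lt)))
  one : length (containing B t') ≡ 1
  one = length-distinct (AllPairsₚ.filter⁺ _ d) (∈-containing⁺ {B} F∈ t'F) λ G∈ →
    let p , q = ∈-containing⁻ B t' G∈ in uniq p (q ∘ t⊆t')

-- Stellar equivalence.

fresh : ∀ (xs : List ℤ) → ∃ λ w → w ∉ xs
fresh xs = + suc (bound xs) , λ w∈ → ℕₚ.<⇒≱ ℕₚ.≤-refl (≤bound w∈)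
  where
  bound : List ℤ → ℕ
  bound [] = 0
  bound (x ∷ xs) = ℤ.∣ x ∣ + bound xs
  ≤bound : ∀ {x xs} → x ∈ xs → ℤ.∣ x ∣ ≤ bound xs
  ≤bound (here refl) = ℕₚ.m≤m+n _ _
  ≤bound {xs = y ∷ ys} (there p) = ℕₚ.≤-trans (≤bound p) (ℕₚ.m≤n+m _ ℤ.∣ y ∣)

face⊆ : ∀ {K σ τ} → σ ⊆ τ → Face K τ → Face K σ
face⊆ s = Any.map (λ p {x} → p {x} ∘ s {x})

face-refl : ∀ {K : FacetList} {τ} → τ ∈ K → Face K τ
face-refl = Any.map λ e {x} → subst (x ∈_) e

_≈F_ : FacetList → FacetList → Set
K ≈F L = ∀ ρ → Face K ρ ⇔ Face L ρ

≈F⇒equivalent : ∀ {K L} → K ≈F L → StellarEquivalent K L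
≈F⇒equivalent e = fwd (iso id (λ _ _ p → p) λ ρ → mk⇔
  (λ f → ρ , Equivalence.from (e ρ) f , map-id⊆ ρ)
  (λ (τ , f , s , _) → Equivalence.to (e ρ) (face⊆ (subst (_ ∈_) (Listₚ.map-id τ) ∘ s) f))) ◅ ε
  where
  map-id⊆ : ∀ ρ → ρ ≋ map id ρ
  map-id⊆ ρ = subst (_ ∈_) (sym (Listₚ.map-id ρ)) , subst (_ ∈_) (Listₚ.map-id ρ)

∈-del⁻ : ∀ {x y ys} → y ∈ del x ys → y ∈ ys × y ≢ x
∈-del⁻ {ys = ys} = ∈-filter⁻ _ {xs = ys}

∈-del⁺ : ∀ {x y ys} → y ∈ ys → y ≢ x → y ∈ del x ys
∈-del⁺ = ∈-filter⁺ _

∈-∷⁻ : ∀ {x y : ℤ} {ys} → x ∈ y ∷ ys → x ≢ y → x ∈ ys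
∈-∷⁻ (here e) ne = ⊥-elim (ne e)
∈-∷⁻ (there p) _ = p

_∩_ _∖_ : Simplex → Simplex → Simplex
ρ ∩ σ = filter (_∈? σ) ρ
ρ ∖ σ = filter (λ x → ¬? (x ∈? σ)) ρ

module _ {ρ σ : Simplex} where
  ∈-∩⁻ : ∀ {x} → x ∈ ρ ∩ σ → x ∈ ρ × x ∈ σ
  ∈-∩⁻ = ∈-filter⁻ (_∈? σ) {xs = ρ}

  ∈-∖⁻ : ∀ {x} → x ∈ ρ ∖ σ → x ∈ ρ × x ∉ σ
  ∈-∖⁻ = ∈-filter⁻ (λ x → ¬? (x ∈? σ)) {xs = ρ}

  ∩∖-⊇ : ρ ⊆ (ρ ∩ σ) ++ (ρ ∖ σ)
  ∩∖-⊇ {x} x∈ with x ∈? σ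
  ... | yes p = ∈-++⁺ˡ (∈-filter⁺ (_∈? σ) x∈ p)
  ... | no p = ∈-++⁺ʳ (ρ ∩ σ) (∈-filter⁺ (λ x → ¬? (x ∈? σ)) x∈ p)

++-⊆ : ∀ {xs ys zs : Simplex} → xs ⊆ zs → ys ⊆ zs → xs ++ ys ⊆ zs
++-⊆ {xs} p q x∈ = [ p , q ]′ (∈-++⁻ xs x∈)

++-swap : ∀ (xs : Simplex) {ys} → xs ++ ys ⊆ ys ++ xs
++-swap xs {ys} = ++-⊆ (∈-++⁺ʳ ys) ∈-++⁺ˡ

-- A facet list for `StellarSd`: deleting one y of σ from a facet and adding w gives the facets of w
-- * ∂σ * lk σ. `split` takes the decision as an argument in a named module, so that proofs can
-- match on it.
stellar : FacetList → Simplex → ℤ → FacetList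
stellar K σ w = concatMap (λ τ → split τ (σ ⊆? τ)) K
  module Stellar where
  split : ∀ τ → Dec (σ ⊆ τ) → FacetList
  split τ (yes _) = map (λ y → w ∷ del y τ) σ
  split τ (no _) = [ τ ]

module _ {K : FacetList} {σ : Simplex} {w : ℤ} where
  open Stellar K σ w

  -- A face without w avoids the deleted y and is old. In a face with w, the remaining vertices
  -- inside and outside σ serve as α and β.
  stellar-sound : ∀ {ρ} → Face (stellar K σ w) ρ → StellarSd K σ w ρ
  stellar-sound {ρ} f with find f
  ... | τ' , τ'∈ , ρτ' with find (∈-concatMap⁻ _ {xs = K} τ'∈)
  ... | τ , τ∈ , p = aux (σ ⊆? τ) p
    where
    aux : (d : Dec (σ ⊆ τ)) → τ' ∈ split τ d → StellarSd K σ w ρ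
    aux (no n) (here refl) = inj₁ (lose τ∈ ρτ' , λ s → n (ρτ' ∘ s))
    aux (yes s) p with ∈-map⁻ (λ y → w ∷ del y τ) p
    ... | y , y∈ , refl with w ∈? ρ
    ... | no w∉ = inj₁ (lose τ∈ (proj₁ ∘ ∈-del⁻ ∘ sub) , λ s → proj₂ (∈-del⁻ {y} {y} {τ} (sub (s y∈))) refl)
      where
      sub : ρ ⊆ del y τ
      sub x∈ = ∈-∷⁻ (ρτ' x∈) λ { refl → w∉ x∈ }
    ... | yes w∈ = inj₂ (del w ρ ∩ σ , del w ρ ∖ σ , proj₂ ∘ ∈-∩⁻ {del w ρ} ,
        (λ s → proj₂ (∈-del⁻ {y} {y} {τ} (sub (proj₁ (∈-∩⁻ {del w ρ} (s y∈))))) refl) ,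
        All.tabulate (proj₂ ∘ ∈-∖⁻ {del w ρ}) ,
        lose τ∈ (++-⊆ s (proj₁ ∘ ∈-del⁻ ∘ sub ∘ proj₁ ∘ ∈-∖⁻ {del w ρ})) ,
        to , ∷-⊆ w∈ (++-⊆ (proj₁ ∘ ∈-del⁻ ∘ proj₁ ∘ ∈-∩⁻ {del w ρ}) (proj₁ ∘ ∈-del⁻ ∘ proj₁ ∘ ∈-∖⁻ {del w ρ})))
      where
      sub : del w ρ ⊆ del y τ
      sub x∈ = let p , ne = ∈-del⁻ {ys = ρ} x∈ in ∈-∷⁻ (ρτ' p) ne
      to : ρ ⊆ w ∷ (del w ρ ∩ σ) ++ (del w ρ ∖ σ)
      to {x} x∈ with x ℤ.≟ w
      ... | yes e = here e
      ... | no ne = there (∩∖-⊇ (∈-del⁺ x∈ ne))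

  stellar-complete : ∀ {ρ} → StellarSd K σ w ρ → Face (stellar K σ w) ρ
  stellar-complete {ρ} (inj₁ (f , n)) with find f
  ... | τ , τ∈ , ρτ = let τ' , p , s = aux (σ ⊆? τ) in lose (∈-concatMap⁺ _ (lose τ∈ p)) s
    where
    aux : (d : Dec (σ ⊆ τ)) → ∃ λ τ' → τ' ∈ split τ d × ρ ⊆ τ'
    aux (no _) = τ , here refl , ρτ
    aux (yes s) = let y , y∈ , y∉ = ⊈⇒∃ n in
      w ∷ del y τ , ∈-map⁺ _ y∈ , λ x∈ → there (∈-del⁺ (ρτ x∈) λ { refl → y∉ x∈ })
  stellar-complete {ρ} (inj₂ (α , β , ασ , n , dis , f , ρ⊆ , _)) with find f
  ... | τ , τ∈ , sβ = let τ' , p , s = aux (σ ⊆? τ) in lose (∈-concatMap⁺ _ (lose τ∈ p)) s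
    where
    aux : (d : Dec (σ ⊆ τ)) → ∃ λ τ' → τ' ∈ split τ d × ρ ⊆ τ'
    aux (no m) = ⊥-elim (m (sβ ∘ ∈-++⁺ˡ))
    aux (yes s) with ⊈⇒∃ n
    ... | y , y∈ , y∉ = w ∷ del y τ , ∈-map⁺ _ y∈ ,
      ∷⁺ʳ w (++-⊆ (λ x∈ → ∈-del⁺ (s (ασ x∈)) λ { refl → y∉ x∈ })
                  (λ x∈ → ∈-del⁺ (sβ (∈-++⁺ʳ σ x∈)) λ { refl → All.lookup dis x∈ y∈ })) ∘ ρ⊆

  -- L is any list with the right faces, so that both sides of a flip can be subdivided onto the
  -- same list.
  stellar-step : σ ≢ [] → Face K σ → ¬ Face K [ w ] → ∀ {L} → L ≈F stellar K σ w → Step K L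
  stellar-step ne f wn e = subdiv σ ne f w wn λ ρ →
    mk⇔ (stellar-sound ∘ Equivalence.to (e ρ)) (Equivalence.from (e ρ) ∘ stellar-complete)

-- Bistellar flips.

Nested : Simplex → Simplex → Set
Nested α σ = α ⊆ σ × ¬ (σ ⊆ α)

-- The star S * ∂R of S is replaced by ∂S * R.
record Flip (K K' : FacetList) (S R : Simplex) : Set where
  field
    sound : ∀ {ρ} → Face K' ρ → (Face K ρ ⊎ ρ ⊆ R ++ S) × ¬ (S ⊆ ρ)
    complete : ∀ {ρ} → Face K ρ ⊎ ρ ⊆ R ++ S → ¬ (S ⊆ ρ) → Face K' ρ
    unique : Unique (R ++ S)
    five : length (R ++ S) ≡ 5
    three≤ : 3 ≤ length S
    non-empty : R ≢ []
    non-face : ¬ Face K R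
    link⁻ : ∀ {β} → Face K (S ++ β) → All (_∉ S) β → β ⊆ R
    link⁺ : ∀ {β} → Nested β R → Face K (S ++ β)

∉-++ : ∀ {xs ys : List ℤ} → Unique (xs ++ ys) → ∀ {x} → x ∈ xs → x ∉ ys
∉-++ {x ∷ xs} (n ∷ _) (here refl) q = All.lookup n (∈-++⁺ʳ xs q) refl
∉-++ {x ∷ xs} (_ ∷ u) (there p) q = ∉-++ u p q

unique-++ʳ : ∀ (xs : List ℤ) {ys} → Unique (xs ++ ys) → Unique ys
unique-++ʳ [] u = u
unique-++ʳ (x ∷ xs) (_ ∷ u) = unique-++ʳ xs u

inhabited : ∀ {xs : Simplex} → xs ≢ [] → ∃ (_∈ xs)
inhabited {[]} n = ⊥-elim (n refl)
inhabited {x ∷ _} _ = x , here refl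

module _ {K K' : FacetList} {S R : Simplex} (fl : Flip K K' S R) where
  open Flip fl

  S≢[] : S ≢ []
  S≢[] refl = case three≤ of λ ()

  S⊈R : ¬ (S ⊆ R)
  S⊈R s = let _ , x∈ = inhabited S≢[] in ∉-++ unique (s x∈) x∈

  face-S : Face K S
  face-S = face⊆ ∈-++⁺ˡ (link⁺ {[]} ((λ ()) , λ s → case s (proj₂ (inhabited non-empty)) of λ ()))

  -- Such a ρ lies in S * ∂R, which is the star of S in K.
  old-face : ∀ {ρ} → ¬ (R ⊆ ρ) → ρ ⊆ R ++ S → Face K ρ
  old-face {ρ} n s = face⊆ sub (link⁺ (proj₂ ∘ ∈-∩⁻ {ρ} , λ r → n (proj₁ ∘ ∈-∩⁻ {ρ} ∘ r)))
    where
    sub : ρ ⊆ S ++ (ρ ∩ R)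
    sub x∈ with ∈-++⁻ R (s x∈)
    ... | inj₁ p = ∈-++⁺ʳ S (∈-filter⁺ (_∈? R) x∈ p)
    ... | inj₂ p = ∈-++⁺ˡ p

  -- Sharpens `sound`: the faces that are really new all contain R.
  classify : ∀ {ρ} → Face K' ρ → (Face K ρ ⊎ (R ⊆ ρ × ρ ⊆ R ++ S)) × ¬ (S ⊆ ρ)
  classify {ρ} f with sound f
  ... | inj₁ g , n = inj₁ g , n
  ... | inj₂ s , n with R ⊆? ρ
  ... | yes r = inj₂ (r , s) , n
  ... | no r = inj₁ (old-face r s) , n

  -- Starring S in K and starring R in K' both fill the flipped region with w * ∂S * ∂R. Hence α and
  -- β, the parts in the two boundaries, exchange roles.
  common : ∀ w → stellar K S w ≈F stellar K' R w
  common w ρ = mk⇔ (stellar-complete ∘ to ∘ stellar-sound) (stellar-complete ∘ from ∘ stellar-sound)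
    where
    to : StellarSd K S w ρ → StellarSd K' R w ρ
    to (inj₁ (f , n)) = inj₁ (complete (inj₁ f) n , λ r → non-face (face⊆ r f))
    to (inj₂ (α , β , ασ , n , dis , f , ρ≋)) =
      inj₂ (β , α , βR , R⊈β , All.tabulate (λ x∈ r → ∉-++ unique r (ασ x∈)) ,
            complete (inj₂ (++-⊆ ∈-++⁺ˡ (∈-++⁺ʳ R ∘ ασ))) S⊈ , ≋-trans ρ≋ (∷⁺ʳ w (++-swap α) , ∷⁺ʳ w (++-swap β)))
      where
      βR : β ⊆ R
      βR = link⁻ f dis
      R⊈β : ¬ (R ⊆ β)
      R⊈β r = non-face (face⊆ (∈-++⁺ʳ S ∘ r) f)
      S⊈ : ¬ (S ⊆ R ++ α)
      S⊈ s = n λ x∈ → case ∈-++⁻ R (s x∈) of λ where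
        (inj₁ p) → ⊥-elim (∉-++ unique p x∈)
        (inj₂ p) → p
    from : StellarSd K' R w ρ → StellarSd K S w ρ
    from (inj₁ (f , n)) with classify f
    ... | inj₁ g , m = inj₁ (g , m)
    ... | inj₂ (r , _) , _ = ⊥-elim (n r)
    from (inj₂ (α , β , αR , n , dis , f , ρ≋)) =
      inj₂ (β , α , βS , S⊈β , All.tabulate (λ x∈ → ∉-++ unique (αR x∈)) ,
            link⁺ (αR , n) , ≋-trans ρ≋ (∷⁺ʳ w (++-swap α) , ∷⁺ʳ w (++-swap β)))
      where
      βS : β ⊆ S
      βS x∈ with classify f
      ... | inj₁ g , _ = ⊥-elim (non-face (face⊆ ∈-++⁺ˡ g))
      ... | inj₂ (_ , s) , _ with ∈-++⁻ R (s (∈-++⁺ʳ R x∈))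
      ... | inj₁ p = ⊥-elim (All.lookup dis x∈ p)
      ... | inj₂ p = p
      S⊈β : ¬ (S ⊆ β)
      S⊈β s = proj₂ (classify f) (∈-++⁺ʳ R ∘ s)

  flip⇒equivalent : StellarEquivalent K K'
  flip⇒equivalent with fresh (concat (K ++ K'))
  ... | w , w∉ =
    fwd (stellar-step S≢[] face-S (w∉ ∘ subst (w ∈_) (Listₚ.concat-++ K K') ∘ ∈-++⁺ˡ ∘ used) λ _ → mk⇔ id id) ◅
    bwd (stellar-step non-empty (complete (inj₂ ∈-++⁺ˡ) S⊈R)
      (w∉ ∘ subst (w ∈_) (Listₚ.concat-++ K K') ∘ ∈-++⁺ʳ (concat K) ∘ used) (common w)) ◅ ε
    where
    used : ∀ {L} → Face L [ w ] → w ∈ concat L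
    used {L} f = let τ , τ∈ , s = find f in ∈-concat⁺′ (s (here refl)) τ∈

  -- A flip destroys only faces containing S, and S has at least three vertices.
  flip-small : ∀ {ρ} → length ρ ≤ 2 → Face K ρ → Face K' ρ
  flip-small l f = complete (inj₁ f) λ s →
    ℕₚ.<⇒≱ ℕₚ.≤-refl (ℕₚ.≤-trans three≤ (ℕₚ.≤-trans (unique-⊆-length (unique-++ʳ R unique) s) l))

-- Triangles in at most two tetrahedra

Pseudomanifold : FacetList → Set
Pseudomanifold K = ∀ {t x y z} → Tri t → Unique (x ∷ y ∷ z ∷ t) → Face K (x ∷ t) → Face K (y ∷ t) → Face K (z ∷ t) → ⊥

module _ {K K' : FacetList} {S R : Simplex} (fl : Flip K K' S R) (pm : Pseudomanifold K) where
  open Flip fl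

  -- x∷t is a new face.  If x ∉ R, all three facets are new; otherwise t ∪ {s},
  -- with s the vertex of S missing from x∷t, is a third facet of K through t.
  private
    new⇒⊥ : ∀ {t x y z} → Tri t → Unique (x ∷ y ∷ z ∷ t) → R ⊆ x ∷ t → x ∷ t ⊆ R ++ S →
      ¬ (S ⊆ x ∷ t) → Face K' (y ∷ t) → Face K' (z ∷ t) → ⊥
    new⇒⊥ {t} {x} {y} {z} (ut , lt) u@((x≢y ∷ x≢z ∷ x≢t) ∷ (y≢z ∷ y≢t) ∷ z≢t ∷ _) R⊆ ⊆RS S⊈ fy fz with x ∈? R
    ... | no x∉ = ℕₚ.<⇒≱ ℕₚ.≤-refl
          (subst₂ _≤_ (cong (λ k → 3 + k) lt) five (unique-⊆-length u six))
      where
      R⊆t : R ⊆ t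
      R⊆t r∈ = ∈-∷⁻ (R⊆ r∈) λ { refl → x∉ r∈ }
      other : ∀ {y} → Face K' (y ∷ t) → y ∈ R ++ S
      other f with classify fl f
      ... | inj₁ g , _ = ⊥-elim (non-face (face⊆ (there ∘ R⊆t) g))
      ... | inj₂ (_ , s) , _ = s (here refl)
      -- Three new tetrahedra over t would place six distinct vertices in `R ++ S`, which has five.
      six : x ∷ y ∷ z ∷ t ⊆ R ++ S
      six (here e) = ⊆RS (here e)
      six (there (here refl)) = other fy
      six (there (there (here refl))) = other fz
      six (there (there (there p))) = ⊆RS (there p)
    ... | yes x∈ with ⊈⇒∃ {R ++ S} {x ∷ t} (λ s → S⊈ (s ∘ ∈-++⁺ʳ R))
    ... | s , s∈RS , s∉ = pm (ut , lt)
          ((s≢ S⊈y ∷ s≢ S⊈z ∷ All.tabulate (λ {q} p e → s∉ (there (subst (_∈ t) (sym e) p)))) ∷ AllPairs.tail u)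
          face-s oldy oldz
      where
      uxt : Unique (x ∷ t)
      uxt = x≢t ∷ ut
      s∈ : s ∈ S
      s∈ = [ (λ r → ⊥-elim (s∉ (R⊆ r))) , id ]′ (∈-++⁻ R s∈RS)
      full : R ++ S ⊆ s ∷ x ∷ t
      full = unique-⊆-full (∉⇒unique-∷ s∉ uxt) (∷-⊆ s∈RS ⊆RS)
        (ℕₚ.≤-reflexive (trans five (cong (λ k → 2 + k) (sym lt))))
      S⊆ : S ⊆ s ∷ t
      S⊆ q with full (∈-++⁺ʳ R q)
      ... | here e = here e
      ... | there (here refl) = ⊥-elim (∉-++ unique x∈ q)
      ... | there (there p) = there p
      face-s : Face K (s ∷ t)
      face-s = old-face fl (λ r → case r x∈ of λ where
          (here e) → s∉ (here (sym e))
          (there p) → All.lookup x≢t p refl)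
        (∷-⊆ s∈RS (⊆RS ∘ there))
      oldFace : ∀ {y} → x ≢ y → Face K' (y ∷ t) → Face K (y ∷ t)
      oldFace ne f with classify fl f
      ... | inj₁ g , _ = g
      ... | inj₂ (r , _) , _ = case r x∈ of λ where
        (here e) → ⊥-elim (ne e)
        (there p) → ⊥-elim (All.lookup x≢t p refl)
      oldy = oldFace x≢y fy
      oldz = oldFace x≢z fz
      S⊈y = proj₂ (classify fl fy)
      S⊈z = proj₂ (classify fl fz)
      -- If s were y, the tetrahedron y∷t would contain S, but no face of K' does.
      s≢ : ∀ {y} → ¬ (S ⊆ y ∷ t) → s ≢ y
      s≢ n refl = n S⊆

  flip-pseudomanifold : Pseudomanifold K'
  flip-pseudomanifold tri u@((x≢y ∷ x≢z ∷ x≢t) ∷ (y≢z ∷ y≢t) ∷ z≢t ∷ ut) fx fy fz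
    with classify fl fx | classify fl fy | classify fl fz
  ... | inj₁ gx , _ | inj₁ gy , _ | inj₁ gz , _ = pm tri u gx gy gz
  ... | inj₂ (r , s) , n | _ | _ = new⇒⊥ tri u r s n fy fz
  ... | inj₁ _ , _ | inj₂ (r , s) , n | _ =
    new⇒⊥ tri (((x≢y ∘ sym) ∷ y≢z ∷ y≢t) ∷ (x≢z ∷ x≢t) ∷ z≢t ∷ ut) r s n fx fz
  ... | inj₁ _ , _ | inj₁ _ , _ | inj₂ (r , s) , n =
    new⇒⊥ tri (((x≢z ∘ sym) ∷ (y≢z ∘ sym) ∷ z≢t) ∷ (x≢y ∷ x≢t) ∷ y≢t ∷ ut) r s n fx fy

length-del-unique : ∀ {x ys} → Unique ys → x ∈ ys → suc (length (del x ys)) ≡ length ys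
length-del-unique {x} {ys} u x∈ = ℕₚ.≤-antisym (length-del x∈)
  (unique-⊆-length u λ {y} y∈ → case y ℤ.≟ x of λ where
    (yes e) → here e
    (no ne) → there (∈-del⁺ y∈ ne))

del-unique : ∀ {x ys} → Unique ys → Unique (x ∷ del x ys)
del-unique {x} {ys} u = ∉⇒unique-∷ (λ p → proj₂ (∈-del⁻ {ys = ys} p) refl) (AllPairsₚ.filter⁺ _ u)

≋-del : ∀ {x F} → x ∈ F → F ≋ (x ∷ del x F)
≋-del {x} {F} x∈ = to , ∷-⊆ x∈ (proj₁ ∘ ∈-del⁻)
  where
  to : F ⊆ x ∷ del x F
  to {y} y∈ with y ℤ.≟ x
  ... | yes e = here e
  ... | no ne = there (∈-del⁺ y∈ ne)

del-tri : ∀ {x F} → Tet F → x ∈ F → Tri (del x F)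
del-tri (u , l) x∈ = tail-unique (del-unique u) , ℕₚ.suc-injective (trans (length-del-unique u x∈) l)

apex : ∀ {t F} → Tri t → Tet F → t ⊆ F → ∃ λ a → a ∉ t × a ∈ F × F ⊆ a ∷ t
apex {t} {F} (ut , lt) (uF , lF) s with tri-⊂-tet (ut , lt) (uF , lF) s
... | a , a∈ , a∉ = a , a∉ , a∈ , unique-⊆-full (∉⇒unique-∷ a∉ ut) (∷-⊆ a∈ s)
  (ℕₚ.≤-reflexive (trans lF (cong suc (sym lt))))

-- A tetrahedron over t is t together with an apex. Equal apexes give equal tetrahedra, and three
-- distinct ones are excluded.
pseudomanifold-three : ∀ {K} → Pseudomanifold K → ∀ {t A B C} → Tri t → Tet A → Tet B → Tet C →
  Face K A → Face K B → Face K C → t ⊆ A → t ⊆ B → t ⊆ C → A ≋ B ⊎ A ≋ C ⊎ B ≋ C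
pseudomanifold-three pm tri tA tB tC fA fB fC sA sB sC with apex tri tA sA | apex tri tB sB | apex tri tC sC
... | a , a∉ , a∈ , A⊆ | b , b∉ , b∈ , B⊆ | c , c∉ , c∈ , C⊆ with a ℤ.≟ b | a ℤ.≟ c | b ℤ.≟ c
... | yes refl | _ | _ = inj₁ (∷-⊆ b∈ sB ∘ A⊆ , ∷-⊆ a∈ sA ∘ B⊆)
... | no _ | yes refl | _ = inj₂ (inj₁ (∷-⊆ c∈ sC ∘ A⊆ , ∷-⊆ a∈ sA ∘ C⊆))
... | no _ | no _ | yes refl = inj₂ (inj₂ (∷-⊆ c∈ sC ∘ B⊆ , ∷-⊆ b∈ sB ∘ C⊆))
... | no ab | no ac | no bc = ⊥-elim (pm tri
  ((ab ∷ ac ∷ proj₁' (∉⇒unique-∷ a∉ (proj₁ tri))) ∷ (bc ∷ proj₁' (∉⇒unique-∷ b∉ (proj₁ tri))) ∷ ∉⇒unique-∷ c∉ (proj₁ tri))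
  (face⊆ (∷-⊆ a∈ sA) fA) (face⊆ (∷-⊆ b∈ sB) fB) (face⊆ (∷-⊆ c∈ sC) fC))
  where
  proj₁' : ∀ {x : ℤ} {xs} → Unique (x ∷ xs) → All (x ≢_) xs
  proj₁' (p ∷ _) = p

-- Stacked balls.

data Stacked : FacetList → Set where
  root : ∀ {F} → Tet F → Stacked [ F ]
  -- The head of the list is the tetrahedron attached last; `F ⊆ x ∷ G` says that the triangle of F
  -- opposite x lies in G.
  add  : ∀ {F S x G} → Tet F → x ∈ F → G ∈ S → F ⊆ x ∷ G → All (x ∉_) S → Stacked S → Stacked (F ∷ S)

stacked-tets : ∀ {S} → Stacked S → All Tet S
stacked-tets (root t) = t ∷ []
stacked-tets (add t _ _ _ _ s) = t ∷ stacked-tets s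

stacked-distinct : ∀ {S} → Stacked S → Distinct S
stacked-distinct (root t) = [] ∷ []
stacked-distinct (add t x∈ _ _ x∉ s) = All.map (λ n (p , _) → n (p x∈)) x∉ ∷ stacked-distinct s

coned : FacetList → FacetList → ℤ → FacetList
coned K S v = diff K S ++ joinV (bd S) v

-- Boundary triangles enter through `Bd` rather than as entries of `bd`, so every ordering of their
-- vertices is accepted.
data ConedFace (K S : FacetList) (v : ℤ) (ρ : Simplex) : Set where
  old : ∀ {τ} → τ ∈ K → ¬ Any (τ ≋_) S → ρ ⊆ τ → ConedFace K S v ρ
  new : ∀ {t} → Tri t → Bd S t → ρ ⊆ v ∷ t → ConedFace K S v ρ

module _ {K S : FacetList} {v : ℤ} (tets : All Tet S) where
  coned-sound : ∀ {ρ} → Face (coned K S v) ρ → ConedFace K S v ρ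
  coned-sound f with find f
  ... | τ , τ∈ , s with ∈-++⁻ (diff K S) τ∈
  ... | inj₁ p = let q , n = ∈-diff⁻ K S p in old q n s
  ... | inj₂ p with ∈-map⁻ (v ∷_) p
  ... | t , t∈ , refl = let tri , b = bd-sound tets t∈ in new tri b s

  coned-complete : Distinct S → ∀ {ρ} → ConedFace K S v ρ → Face (coned K S v) ρ
  coned-complete d (old τ∈ n s) = lose (∈-++⁺ˡ (∈-diff⁺ τ∈ n)) s
  coned-complete d (new tri b s) = let t' , t'∈ , _ , q = bd-complete d tets tri b in
    lose (∈-++⁺ʳ (diff K S) (∈-map⁺ (v ∷_) t'∈)) (∷⁺ʳ v q ∘ s)

record ConeSphere (K S : FacetList) (v : ℤ) : Set where
  field
    equivalent : StellarEquivalent K (coned K S v)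
    pm : Pseudomanifold (coned K S v)
    small : ∀ {ρ} → length ρ ≤ 2 → Face K ρ → Face (coned K S v) ρ
    edge : ∀ {F u} → F ∈ S → u ∈ F → Face (coned K S v) (v ∷ u ∷ [])

three⊈two : ∀ {t : Simplex} {a b : ℤ} → Unique t → 3 ≤ length t → ¬ (t ⊆ a ∷ b ∷ [])
three⊈two u l s = ℕₚ.<⇒≱ ℕₚ.≤-refl (ℕₚ.≤-trans l (unique-⊆-length u s))

module _ {K : FacetList} {v : ℤ} (tets : All Tet K) (pm : Pseudomanifold K) (v∉ : All (v ∉_) K) where

  private
    tet-of : ∀ {F} → Tet F → Face K F → ∃ λ τ → τ ∈ K × F ≋ τ
    tet-of tF f = let τ , τ∈ , s = find f in τ , τ∈ , tet-⊆ tF (All.lookup tets τ∈) s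

    v∉face : ∀ {F} → Face K F → v ∉ F
    v∉face f v∈ = let τ , τ∈ , s = find f in All.lookup v∉ τ∈ (s v∈)

  -- Starring a tetrahedron is the flip with R = {v}. The boundary of a point has only the empty
  -- face, and so has the link of F, since no face of K exceeds a tetrahedron.
  flip-root : ∀ {F} → Tet F → Face K F → Flip K (coned K [ F ] v) F [ v ]
  flip-root {F} tF@(uF , lF) fF = record
    { sound = λ f → sound (coned-sound {K} (tF ∷ []) f)
    ; complete = λ p n → coned-complete (tF ∷ []) ([] ∷ []) (complete p n)
    ; unique = ∉⇒unique-∷ (v∉face fF) uF
    ; five = cong suc lF
    ; three≤ = subst (3 ≤_) (sym lF) (s≤s (s≤s (s≤s z≤n)))
    ; non-empty = λ ()
    ; non-face = λ f → v∉face f (here refl)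
    ; link⁻ = λ f dis {x} x∈ → ⊥-elim (All.lookup dis x∈ (link f (∈-++⁺ʳ F x∈)))
    ; link⁺ = λ (s , n) → face⊆ (++-⊆ id λ x∈ → ⊥-elim (n (λ { (here refl) → single (s x∈) x∈ }))) fF
    }
    where
    single : ∀ {β x} → x ∈ [ v ] → x ∈ β → v ∈ β
    single (here refl) q = q
    link : ∀ {β} → Face K (F ++ β) → F ++ β ⊆ F
    link f = let τ , τ∈ , s = find f in proj₂ (tet-⊆ tF (All.lookup tets τ∈) (s ∘ ∈-++⁺ˡ)) ∘ s
    sound : ∀ {ρ} → ConedFace K [ F ] v ρ → (Face K ρ ⊎ ρ ⊆ v ∷ F) × ¬ (F ⊆ ρ)
    sound (old τ∈ n s) = inj₁ (lose τ∈ s) , λ r →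
      n (here (≋-sym (tet-⊆ tF (All.lookup tets τ∈) (s ∘ r))))
    sound (new {t} (ut , lt) (_ , here refl , tF , _) s) = inj₂ (∷⁺ʳ v tF ∘ s) , λ r →
      ℕₚ.<⇒≱ ℕₚ.≤-refl (subst₂ _≤_ lF lt (unique-⊆-length uF
        λ x∈ → ∈-∷⁻ (s (r x∈)) λ { refl → v∉face fF x∈ }))
    cap : ∀ {ρ} → ρ ⊆ v ∷ F → ¬ (F ⊆ ρ) → ConedFace K [ F ] v ρ
    cap s n with ⊈⇒∃ n
    ... | y , y∈ , y∉ = new (del-tri tF y∈)
      (F , here refl , (proj₁ ∘ ∈-del⁻) , λ { (here refl) _ → ≋-refl })
      λ x∈ → case s x∈ of λ where
        (here e) → here e
        (there p) → there (∈-del⁺ p λ { refl → y∉ x∈ })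
    complete : ∀ {ρ} → Face K ρ ⊎ ρ ⊆ v ∷ F → ¬ (F ⊆ ρ) → ConedFace K [ F ] v ρ
    complete (inj₂ s) n = cap s n
    complete (inj₁ f) n with find f
    ... | τ , τ∈ , s with ≋? τ [ F ]
    ... | yes (here e) = cap (there ∘ proj₁ e ∘ s) n
    ... | no m = old τ∈ m s

  -- In the coned complex the triangle t opposite x lies only in v∷t and F, its other tetrahedron G
  -- having been removed. Its link is therefore {v, x}, the boundary of the edge that the flip
  -- creates.
  flip-add : ∀ {F S x G} → Tet F → Face K F → (∀ {H} → H ∈ S → Face K H) →
    x ∈ F → G ∈ S → F ⊆ x ∷ G → All (x ∉_) S → Stacked S →
    Flip (coned K S v) (coned K (F ∷ S) v) (del x F) (v ∷ x ∷ [])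
  flip-add {F} {S} {x} {G} tF@(uF , lF) fF fS x∈ G∈ F⊆ x∉ st = record
    { sound = λ f → sound (coned-sound {K} tets' f)
    ; complete = λ p n → coned-complete tets' dist' (complete p n)
    ; unique = ∉⇒unique-∷ v∉xt (del-unique uF)
    ; five = cong (λ k → 2 + k) (proj₂ tri)
    ; three≤ = ℕₚ.≤-reflexive (sym (proj₂ tri))
    ; non-empty = λ ()
    ; non-face = λ f → non-face (coned-sound {K} tetsS f)
    ; link⁻ = λ f dis → link⁻ (coned-sound {K} tetsS f) dis
    ; link⁺ = λ p → coned-complete tetsS distS (link⁺ p)
    }
    where
    tetsS = stacked-tets st
    distS = stacked-distinct st
    tets' : All Tet (F ∷ S)
    tets' = tF ∷ tetsS
    dist' : Distinct (F ∷ S)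
    dist' = stacked-distinct (add tF x∈ G∈ F⊆ x∉ st)
    t = del x F
    tri : Tri t
    tri = del-tri tF x∈
    F≋ : F ≋ (x ∷ t)
    F≋ = ≋-del x∈
    v∉xt : v ∉ x ∷ t
    v∉xt = v∉face fF ∘ proj₂ F≋
    x∉t : x ∉ t
    x∉t = head-∉ (del-unique uF)
    t⊆G : t ⊆ G
    t⊆G y∈ = let p , ne = ∈-del⁻ {ys = F} y∈ in ∈-∷⁻ (F⊆ p) ne
    t⊆F : t ⊆ F
    t⊆F = proj₁ ∘ ∈-del⁻
    F≉ : ∀ {H} → H ∈ S → ¬ (F ⊆ H)
    F≉ H∈ s = All.lookup x∉ H∈ (s x∈)
    -- Among H, G and F two must coincide, and F is not in S because it contains x.
    bdT : Bd S t
    bdT = G , G∈ , t⊆G , λ H∈ t⊆H → case pseudomanifold-three pm tri (All.lookup tetsS H∈) (All.lookup tetsS G∈) tF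
        (fS H∈) (fS G∈) fF t⊆H t⊆G t⊆F of λ where
      (inj₁ e) → e
      (inj₂ (inj₁ e)) → ⊥-elim (F≉ H∈ (proj₂ e))
      (inj₂ (inj₂ e)) → ⊥-elim (F≉ G∈ (proj₂ e))
    F≉S : ∀ {τ} → F ≋ τ → ¬ Any (τ ≋_) S
    F≉S e a = let H , H∈ , e' = find a in F≉ H∈ (proj₁ e' ∘ proj₁ e)
    -- The same count in K: besides G, which belongs to S, only F is left over t.
    only : ∀ {τ} → τ ∈ K → ¬ Any (τ ≋_) S → t ⊆ τ → τ ≋ F
    only τ∈ n s with pseudomanifold-three pm tri (All.lookup tets τ∈) (All.lookup tetsS G∈) tF
      (face-refl τ∈) (fS G∈) fF s t⊆G t⊆F
    ... | inj₁ e = ⊥-elim (n (lose G∈ e))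
    ... | inj₂ (inj₁ e) = e
    ... | inj₂ (inj₂ e) = ⊥-elim (F≉ G∈ (proj₂ e))
    bd-cons⁺ : ∀ {s} → Bd S s → ¬ (s ⊆ F) → Bd (F ∷ S) s
    bd-cons⁺ (H , H∈ , s , u) n = H , there H∈ , s , λ where
      (here refl) q → ⊥-elim (n q)
      (there p) q → u p q
    -- A triangle of F that also lies in a tetrahedron of S becomes interior; this is how t leaves
    -- the boundary.
    bd-cons⁻ : ∀ {s} → Bd (F ∷ S) s → (s ⊆ F × (∀ {H} → H ∈ S → ¬ (s ⊆ H))) ⊎ (Bd S s × ¬ (s ⊆ F))
    bd-cons⁻ (H , here refl , s , u) = inj₁ (s , λ H∈ q → F≉ H∈ (proj₂ (u (there H∈) q)))
    bd-cons⁻ (H , there H∈ , s , u) =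
      inj₂ ((H , H∈ , s , u ∘ there) , λ q → F≉ H∈ (proj₁ (u (here refl) q)))
    v∉t : v ∉ t
    v∉t = v∉xt ∘ there
    -- If ρ misses y of t, it lies in the cone over the triangle of F opposite y. That triangle
    -- contains x, which no tetrahedron of S does, so it is on the boundary.
    cap : ∀ {ρ} → ρ ⊆ v ∷ x ∷ t → ¬ (t ⊆ ρ) → ConedFace K (F ∷ S) v ρ
    cap {ρ} s n with ⊈⇒∃ n
    ... | y , y∈ , y∉ = new {t = x ∷ del y t}
      (∉⇒unique-∷ (x∉t ∘ proj₁ ∘ ∈-del⁻) (AllPairsₚ.filter⁺ _ (proj₁ tri)) ,
       trans (length-del-unique (proj₁ tri) y∈) (proj₂ tri))
      (F , here refl , (proj₂ F≋ ∘ ∷⁺ʳ x (proj₁ ∘ ∈-del⁻)) , λ where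
         (here refl) _ → ≋-refl
         (there H∈) q → ⊥-elim (All.lookup x∉ H∈ (q (here refl))))
      sub
      where
      sub : ρ ⊆ v ∷ x ∷ del y t
      sub z∈ with s z∈
      ... | here e = here e
      ... | there (here e) = there (here e)
      ... | there (there p) = there (there (∈-del⁺ p λ { refl → y∉ z∈ }))
    sound : ∀ {ρ} → ConedFace K (F ∷ S) v ρ → (Face (coned K S v) ρ ⊎ ρ ⊆ v ∷ x ∷ t) × ¬ (t ⊆ ρ)
    sound (old τ∈ n s) = inj₁ (coned-complete tetsS distS (old τ∈ (n ∘ there) s)) ,
      λ r → n (here (only τ∈ (n ∘ there) (s ∘ r)))
    sound {ρ} (new {s'} tri' b s) with bd-cons⁻ b
    ... | inj₁ (q , n) = inj₂ (∷⁺ʳ v (proj₁ F≋ ∘ q) ∘ s) , λ r → n G∈ (t⊆G ∘ proj₂ (tri-⊆ tri tri' (tt' r)))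
      where
      tt' : t ⊆ ρ → t ⊆ s'
      tt' r y∈ = ∈-∷⁻ (s (r y∈)) λ { refl → v∉t y∈ }
    ... | inj₂ (b' , n) = inj₁ (coned-complete {K} tetsS distS (new tri' b' s)) ,
      λ r → n (t⊆F ∘ proj₂ (tri-⊆ tri tri' (λ y∈ → ∈-∷⁻ (s (r y∈)) λ { refl → v∉t y∈ })))
    complete' : ∀ {ρ} → ConedFace K S v ρ → ¬ (t ⊆ ρ) → ConedFace K (F ∷ S) v ρ
    complete' (old {τ} τ∈ n s) m with ≋? τ [ F ]
    ... | yes (here e) = cap (there ∘ proj₁ F≋ ∘ proj₁ e ∘ s) m
    ... | no k = old τ∈ (λ { (here e) → k (here e) ; (there p) → n p }) s
    complete' (new {s'} tri' b s) m with s' ⊆? F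
    ... | no k = new tri' (bd-cons⁺ b k) s
    ... | yes k = cap (∷⁺ʳ v (λ y∈ → proj₁ F≋ (k y∈)) ∘ s) m
    complete : ∀ {ρ} → Face (coned K S v) ρ ⊎ ρ ⊆ v ∷ x ∷ t → ¬ (t ⊆ ρ) → ConedFace K (F ∷ S) v ρ
    complete (inj₁ f) = complete' (coned-sound {K} tetsS f)
    complete (inj₂ s) = cap s
    non-face : ¬ ConedFace K S v (v ∷ x ∷ [])
    non-face (old τ∈ _ s) = All.lookup v∉ τ∈ (s (here refl))
    non-face (new _ (H , H∈ , q , _) s) with s (there (here refl))
    ... | here refl = v∉xt (here refl)
    ... | there p = All.lookup x∉ H∈ (q p)
    link⁻ : ∀ {β} → ConedFace K S v (t ++ β) → All (_∉ t) β → β ⊆ v ∷ x ∷ []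
    link⁻ (old τ∈ n s) dis y∈ with proj₁ F≋ (proj₁ (only τ∈ n (s ∘ ∈-++⁺ˡ)) (s (∈-++⁺ʳ t y∈)))
    ... | here e = there (here e)
    ... | there p = ⊥-elim (All.lookup dis y∈ p)
    link⁻ (new {s'} tri' b s) dis y∈ with s (∈-++⁺ʳ t y∈)
    ... | here e = here e
    ... | there p = ⊥-elim (All.lookup dis y∈ (proj₂ (tri-⊆ tri tri'
          (λ z∈ → ∈-∷⁻ (s (∈-++⁺ˡ z∈)) λ { refl → v∉t z∈ })) p))
    link⁺ : ∀ {β} → Nested β (v ∷ x ∷ []) → ConedFace K S v (t ++ β)
    link⁺ {β} (s , n) with v ∈? β
    ... | yes v∈ = new tri bdT (++-⊆ there λ y∈ → case s y∈ of λ where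
            (here e) → here e
            (there (here refl)) → ⊥-elim (n (∷-⊆ v∈ (∷-⊆ y∈ λ ()))))
    ... | no v∉β with tet-of tF fF
    ... | τ , τ∈ , e = old τ∈ (F≉S e) (++-⊆ (proj₁ e ∘ t⊆F) λ y∈ → case s y∈ of λ where
            (here refl) → ⊥-elim (v∉β y∈)
            (there (here refl)) → proj₁ e x∈)

  -- One flip per tetrahedron. An edge {v, u} appears when a tetrahedron containing u is coned, and
  -- later flips keep it by `flip-small`.
  cone-sphere : ∀ {S} → Stacked S → (∀ {F} → F ∈ S → Face K F) → ConeSphere K S v
  cone-sphere (root {F} tF@(uF , lF)) fS = record
    { equivalent = flip⇒equivalent fl
    ; pm = flip-pseudomanifold fl pm
    ; small = flip-small fl
    ; edge = λ { (here refl) u∈ → Flip.complete fl (inj₂ (∷-⊆ (here refl) (∷-⊆ (there u∈) λ ())))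
        (three⊈two uF (subst (3 ≤_) (sym lF) (s≤s (s≤s (s≤s z≤n))))) }
    }
    where fl = flip-root tF (fS (here refl))
  cone-sphere (add {F} {S} {x} tF@(uF , lF) x∈ G∈ F⊆ x∉ st) fS = record
    { equivalent = C.equivalent ◅◅ flip⇒equivalent fl
    ; pm = flip-pseudomanifold fl C.pm
    ; small = λ l f → flip-small fl l (C.small l f)
    ; edge = edge
    }
    where
    module C = ConeSphere (cone-sphere st (fS ∘ there))
    fl = flip-add tF (fS (here refl)) (fS ∘ there) x∈ G∈ F⊆ x∉ st
    edge : ∀ {H u} → H ∈ F ∷ S → u ∈ H → Face (coned K (F ∷ S) v) (v ∷ u ∷ [])
    edge (here refl) u∈ = Flip.complete fl (inj₂ (∷-⊆ (here refl) (∷-⊆ (there (proj₁ (≋-del x∈) u∈)) λ ())))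
      (let tri = del-tri tF x∈ in three⊈two (proj₁ tri) (ℕₚ.≤-reflexive (sym (proj₂ tri))))
    edge (there H∈) u∈ = flip-small fl ℕₚ.≤-refl (C.edge H∈ u∈)

-- Central symmetry.

negS-negS : ∀ σ → negS (negS σ) ≡ σ
negS-negS [] = refl
negS-negS (x ∷ σ) = cong₂ _∷_ (ℤₚ.neg-involutive x) (negS-negS σ)

negF-negF : ∀ F → negF (negF F) ≡ F
negF-negF [] = refl
negF-negF (σ ∷ F) = cong₂ _∷_ (negS-negS σ) (negF-negF F)

∈-negS : ∀ {x σ} → x ∈ σ → ℤ.- x ∈ negS σ
∈-negS = ∈-map⁺ (λ x → ℤ.- x)

∈-negS⁻ : ∀ {x σ} → ℤ.- x ∈ negS σ → x ∈ σ
∈-negS⁻ {x} {σ} p = subst₂ _∈_ (ℤₚ.neg-involutive x) (negS-negS σ) (∈-negS p)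

negS-⊆ : ∀ {σ τ} → σ ⊆ τ → negS σ ⊆ negS τ
negS-⊆ = ⊆-map⁺ (λ x → ℤ.- x)

negS-⊆⁻ : ∀ {σ τ} → negS σ ⊆ negS τ → σ ⊆ τ
negS-⊆⁻ {σ} {τ} s = ∈-negS⁻ ∘ s ∘ ∈-negS

negS-≋ : ∀ {σ τ} → σ ≋ τ → negS σ ≋ negS τ
negS-≋ (p , q) = negS-⊆ p , negS-⊆ q

negS-≋-swap : ∀ {σ τ} → negS σ ≋ τ → σ ≋ negS τ
negS-≋-swap {σ} {τ} e = subst (_≋ negS τ) (negS-negS σ) (negS-≋ e)

negS-unique : ∀ {σ} → Unique σ → Unique (negS σ)
negS-unique = Uniqueₚ.map⁺ ℤₚ.neg-injective

negS-tet : ∀ {σ} → Tet σ → Tet (negS σ)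
negS-tet {σ} (u , l) = negS-unique u , trans (Listₚ.length-map _ σ) l

negS-tri : ∀ {σ} → Tri σ → Tri (negS σ)
negS-tri {σ} (u , l) = negS-unique u , trans (Listₚ.length-map _ σ) l

Any-negF⁺ : ∀ {τ B} → Any (negS τ ≋_) B → Any (τ ≋_) (negF B)
Any-negF⁺ a = Anyₚ.map⁺ (Any.map negS-≋-swap a)

Any-negF⁻ : ∀ {τ B} → Any (negS τ ≋_) (negF B) → Any (τ ≋_) B
Any-negF⁻ {τ} {B} a = subst (Any (τ ≋_)) (negF-negF B) (Any-negF⁺ a)

Any-≋ : ∀ {τ τ'} {B : FacetList} → τ ≋ τ' → Any (τ ≋_) B → Any (τ' ≋_) B
Any-≋ e = Any.map (≋-trans (≋-sym e))

negF-tets : ∀ {B} → All Tet B → All Tet (negF B)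
negF-tets = Allₚ.map⁺ ∘ All.map negS-tet

negF-stacked : ∀ {S} → Stacked S → Stacked (negF S)
negF-stacked (root t) = root (negS-tet t)
negF-stacked (add t x∈ G∈ s n st) = add (negS-tet t) (∈-negS x∈) (∈-map⁺ negS G∈) (negS-⊆ s)
  (Allₚ.map⁺ (All.map (λ x∉ p → x∉ (∈-negS⁻ p)) n)) (negF-stacked st)

negF-Bd : ∀ {S t} → Bd S t → Bd (negF S) (negS t)
negF-Bd {S} {t} (F , F∈ , s , u) = negS F , ∈-map⁺ negS F∈ , negS-⊆ s , aux
  where
  aux : ∀ {G} → G ∈ negF S → negS t ⊆ G → G ≋ negS F
  aux G∈ q with ∈-map⁻ negS G∈
  ... | G' , G'∈ , refl = negS-≋ (u G'∈ (negS-⊆⁻ q))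

negF-Bd⁻ : ∀ {S t} → Bd (negF S) t → Bd S (negS t)
negF-Bd⁻ {S} b = subst (λ S → Bd S _) (negF-negF S) (negF-Bd b)

negF-distinct : ∀ {S} → Distinct S → Distinct (negF S)
negF-distinct = AllPairsₚ.map⁺ ∘ AllPairs.map λ n (p , q) → n (negS-⊆⁻ p , negS-⊆⁻ q)

distinct-↭ : ∀ {S B} → S ↭ B → Distinct S → Distinct B
distinct-↭ Perm.refl d = d
distinct-↭ (Perm.prep _ p) (n ∷ d) = Permₚ.All-resp-↭ p n ∷ distinct-↭ p d
distinct-↭ (Perm.swap x y p) ((n ∷ k) ∷ l ∷ d) =
  ((n ∘ ≋-sym) ∷ Permₚ.All-resp-↭ p l) ∷ Permₚ.All-resp-↭ p k ∷ distinct-↭ p d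
distinct-↭ (Perm.trans p q) d = distinct-↭ q (distinct-↭ p d)

Bd-↭ : ∀ {S B t} → S ↭ B → Bd S t → Bd B t
Bd-↭ p (F , F∈ , s , u) = F , Permₚ.∈-resp-↭ p F∈ , s , u ∘ Permₚ.∈-resp-↭ (↭-sym p)

-- `neg` refers to a boundary triangle of B and not of -B, so that the antipodal map merely
-- exchanges `new` and `neg`.
data ReplacedFace (D B : FacetList) (v : ℤ) (ρ : Simplex) : Set where
  old : ∀ {τ} → τ ∈ D → ¬ Any (τ ≋_) B → ¬ Any (τ ≋_) (negF B) → ρ ⊆ τ → ReplacedFace D B v ρ
  new : ∀ {t} → Tri t → Bd B t → ρ ⊆ v ∷ t → ReplacedFace D B v ρ
  neg : ∀ {t} → Tri t → Bd B t → ρ ⊆ ℤ.- v ∷ negS t → ReplacedFace D B v ρ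

module _ {D B : FacetList} {v : ℤ} (tets : All Tet B) where
  replace-sound : ∀ {ρ} → Face (replace D B v) ρ → ReplacedFace D B v ρ
  replace-sound f with find f
  ... | τ , τ∈ , s with ∈-++⁻ (diff D (B ++ negF B)) τ∈
  ... | inj₁ p = let q , n = ∈-diff⁻ D (B ++ negF B) p in old q (n ∘ Anyₚ.++⁺ˡ) (n ∘ Anyₚ.++⁺ʳ B) s
  ... | inj₂ p with ∈-++⁻ (joinV (bd B) v) p
  ... | inj₁ q with ∈-map⁻ (v ∷_) q
  ... | t , t∈ , refl = let tri , b = bd-sound tets t∈ in new tri b s
  replace-sound f | τ , τ∈ , s | inj₂ p | inj₂ q with ∈-map⁻ (ℤ.- v ∷_) q
  ... | t , t∈ , refl = let tri , b = bd-sound (negF-tets tets) t∈ in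
    neg (negS-tri tri) (negF-Bd⁻ b) (subst (λ t → _ ⊆ ℤ.- v ∷ t) (sym (negS-negS t)) s)

  replace-complete : Distinct B → ∀ {ρ} → ReplacedFace D B v ρ → Face (replace D B v) ρ
  replace-complete d (old τ∈ n k s) =
    lose (∈-++⁺ˡ (∈-diff⁺ τ∈ λ a → [ n , k ]′ (Anyₚ.++⁻ B a))) s
  replace-complete d (new tri b s) = let t' , t'∈ , _ , q = bd-complete d tets tri b in
    lose (∈-++⁺ʳ (diff D (B ++ negF B)) (∈-++⁺ˡ (∈-map⁺ (v ∷_) t'∈))) (∷⁺ʳ v q ∘ s)
  replace-complete d (neg tri b s) =
    let t' , t'∈ , _ , q = bd-complete (negF-distinct d) (negF-tets tets) (negS-tri tri) (negF-Bd b) in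
    lose (∈-++⁺ʳ (diff D (B ++ negF B)) (∈-++⁺ʳ (joinV (bd B) v) (∈-map⁺ (ℤ.- v ∷_) t'∈))) (∷⁺ʳ (ℤ.- v) q ∘ s)

InV-neg : ∀ {m v} → InV m v → InV m (ℤ.- v)
InV-neg (k , p , q , inj₁ refl) = k , p , q , inj₂ refl
InV-neg (k , p , q , inj₂ refl) = k , p , q , inj₁ (ℤₚ.neg-involutive (+ k))

InV-suc : ∀ {m v} → InV m v → InV (suc m) v
InV-suc (k , p , q , e) = k , p , ℕₚ.m≤n⇒m≤1+n q , e

InV-suc⁻ : ∀ {m v} → InV (suc m) v → InV m v ⊎ (v ≡ + suc m ⊎ v ≡ ℤ.- (+ suc m))
InV-suc⁻ {m} (k , p , q , e) with k ℕ.≟ suc m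
... | yes refl = inj₂ e
... | no n = inj₁ (k , p , ℕₚ.≤-pred (ℕₚ.≤∧≢⇒< q n) , e)

¬InV-suc : ∀ {m} → ¬ InV m (+ suc m)
¬InV-suc (k , _ , q , inj₁ refl) = ℕₚ.<⇒≱ ℕₚ.≤-refl q
¬InV-suc (zero , () , _)
¬InV-suc (suc k , _ , _ , inj₂ ())

-- The inductive step from V_m to V_{m+1}

record Sphere (m : ℕ) (K : FacetList) : Set where
  field
    tets : All Tet K
    pm : Pseudomanifold K
    sphere : CombinatorialSphere 3 K
    symmetric : CentrallySymmetric K
    vertices : ∀ {τ v} → τ ∈ K → v ∈ τ → InV m v
    -- The case u = v is included, so the vertices themselves are faces as well.
    edges : ∀ {u v} → InV m u → InV m v → u ≢ ℤ.- v → Face K (u ∷ v ∷ [])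

-- `replace` uses the list B as given, the flips a stacked ordering S of it. The ball S is coned
-- from v and then -S from -v; `disjoint` keeps -S intact in between, and `cover` joins each new
-- vertex to all old ones.
module Replacement {m : ℕ} {D : FacetList} (sp : Sphere m D) (1≤m : 1 ≤ m) {B S : FacetList} (S↭B : S ↭ B) (st : Stacked S)
  (B⊂D : ∀ {F : Simplex} → F ∈ B → Face D F) (disjoint : ∀ {F G : Simplex} → F ∈ B → G ∈ B → ¬ (F ≋ negS G))
  (cover : ∀ {v : ℤ} → InV m v → Any (v ∈_) B) where

  open Sphere sp
  private
    v = + suc m
    D' = replace D B v

    tetsS = stacked-tets st
    tetsB : All Tet B
    tetsB = Permₚ.All-resp-↭ S↭B tetsS
    distS = stacked-distinct st
    distB : Distinct B
    distB = distinct-↭ S↭B distS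

    S⊂B : ∀ {F} → F ∈ S → F ∈ B
    S⊂B = Permₚ.∈-resp-↭ S↭B

    ≋face : ∀ {F} → Tet F → Face D F → ∃ λ τ → τ ∈ D × F ≋ τ
    ≋face tF f = let τ , τ∈ , s = find f in τ , τ∈ , tet-⊆ tF (All.lookup tets τ∈) s

    vertexB : ∀ {F u} → F ∈ B → u ∈ F → InV m u
    vertexB F∈ u∈ = let τ , τ∈ , s = find (B⊂D F∈) in vertices τ∈ (s u∈)

    v∉D : All (v ∉_) D
    v∉D = All.tabulate λ τ∈ v∈ → ¬InV-suc (vertices τ∈ v∈)

    ¬InV-neg : ¬ InV m (ℤ.- v)
    ¬InV-neg = ¬InV-suc ∘ InV-neg

    boundary-vertex : ∀ {t u} → Bd B t → u ∈ t → InV m u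
    boundary-vertex (F , F∈ , s , _) u∈ = vertexB F∈ (s u∈)

    negS-vertex : ∀ {t u} → Bd B t → u ∈ negS t → InV m u
    negS-vertex b u∈ with ∈-map⁻ _ u∈
    ... | w , w∈ , refl = InV-neg (boundary-vertex b w∈)

    D₁ = coned D S v
    D₂ = coned D₁ (negF S) (ℤ.- v)

    data InConed (τ : Simplex) : Set where
      old : τ ∈ D → ¬ Any (τ ≋_) S → InConed τ
      new : ∀ {t} → τ ≡ v ∷ t → Tri t → Bd B t → InConed τ

    D₁-entry : ∀ {τ} → τ ∈ D₁ → InConed τ
    D₁-entry p with ∈-++⁻ (diff D S) p
    ... | inj₁ q = let r , n = ∈-diff⁻ D S q in old r n
    ... | inj₂ q with ∈-map⁻ (v ∷_) q
    ... | t , t∈ , e = let tri , b = bd-sound tetsS t∈ in new e tri (Bd-↭ S↭B b)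

    v-unique : ∀ {t} → Tri t → Bd B t → Tet (v ∷ t)
    v-unique (u , l) b = ∉⇒unique-∷ (¬InV-suc ∘ boundary-vertex b) u , cong suc l

    tets₁ : All Tet D₁
    tets₁ = All.tabulate λ p → case D₁-entry p of λ where
      (old q _) → All.lookup tets q
      (new refl tri b) → v-unique tri b

    -v∉D₁ : All (ℤ.- v ∉_) D₁
    -v∉D₁ = All.tabulate λ p v∈ → case D₁-entry p of λ where
      (old q _) → ¬InV-neg (vertices q v∈)
      (new refl tri b) → case v∈ of λ where
        (here ())
        (there w∈) → ¬InV-neg (boundary-vertex b w∈)

    S⊂D : ∀ {F} → F ∈ S → Face D F
    S⊂D = B⊂D ∘ S⊂B

    C₁ : ConeSphere D S v
    C₁ = cone-sphere tets pm v∉D st S⊂D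

    -- By symmetry -G is a facet of D up to order, and `disjoint` prevents its removal along with S.
    negS⊂D₁ : ∀ {F} → F ∈ negF S → Face D₁ F
    negS⊂D₁ F∈ with ∈-map⁻ negS F∈
    ... | G , G∈ , refl with ≋face (negS-tet (All.lookup tetsS G∈)) (symmetric G (S⊂D G∈))
    ... | τ , τ∈ , e = coned-complete {D} tetsS distS (old τ∈ (λ a → let H , H∈ , e' = find a in
      disjoint (S⊂B H∈) (S⊂B G∈) (≋-sym (≋-trans e e'))) (proj₁ e))

    C₂ : ConeSphere D₁ (negF S) (ℤ.- v)
    C₂ = cone-sphere tets₁ (ConeSphere.pm C₁) -v∉D₁ (negF-stacked st) negS⊂D₁

    toB : ∀ {τ} → Any (τ ≋_) S → Any (τ ≋_) B
    toB = Permₚ.Any-resp-↭ S↭B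
    fromB : ∀ {τ} → Any (τ ≋_) B → Any (τ ≋_) S
    fromB = Permₚ.Any-resp-↭ (↭-sym S↭B)
    negF↭ : negF S ↭ negF B
    negF↭ = Permₚ.map⁺ negS S↭B

    -- The facets v∷t created by the first coning are not removed with -S, since v is outside V_m.
    D₂≈D' : D₂ ≈F D'
    D₂≈D' ρ = mk⇔ (replace-complete {D} tetsB distB ∘ to ∘ coned-sound {D₁} (negF-tets tetsS))
                  (coned-complete (negF-tets tetsS) (negF-distinct distS) ∘ from ∘ replace-sound {D} tetsB)
      where
      to : ConedFace D₁ (negF S) (ℤ.- v) ρ → ReplacedFace D B v ρ
      to (new tri b s) = neg (negS-tri tri) (Bd-↭ S↭B (negF-Bd⁻ b))
        (subst (λ t → ρ ⊆ ℤ.- v ∷ t) (sym (negS-negS _)) s)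
      to (old τ∈ n s) with D₁-entry τ∈
      ... | old q k = old q (k ∘ fromB) (n ∘ Permₚ.Any-resp-↭ (↭-sym negF↭)) s
      ... | new refl tri b = new tri b s
      from : ReplacedFace D B v ρ → ConedFace D₁ (negF S) (ℤ.- v) ρ
      from (old τ∈ n k s) = old (∈-++⁺ˡ (∈-diff⁺ τ∈ (n ∘ toB))) (k ∘ Permₚ.Any-resp-↭ negF↭) s
      from (neg {t} tri b s) = new (negS-tri tri) (negF-Bd (Bd-↭ (↭-sym S↭B) b)) s
      from (new {t} tri b s) with bd-complete distS tetsS tri (Bd-↭ (↭-sym S↭B) b)
      ... | t' , t'∈ , e = old (∈-++⁺ʳ (diff D S) (∈-map⁺ (v ∷_) t'∈)) v∉ (∷⁺ʳ v (proj₂ e) ∘ s)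
        where
        v∉ : ¬ Any ((v ∷ t') ≋_) (negF S)
        v∉ a with find a
        ... | F , F∈ , p , _ with ∈-map⁻ negS F∈
        ... | G , G∈ , refl with ∈-map⁻ _ (p (here refl))
        ... | w , w∈ , q = ¬InV-suc (subst (InV m) (sym q) (InV-neg (vertexB (S⊂B G∈) w∈)))

    up : ∀ {ρ} → Face D₂ ρ → Face D' ρ
    up = Equivalence.to (D₂≈D' _)
    down : ∀ {ρ} → Face D' ρ → Face D₂ ρ
    down = Equivalence.from (D₂≈D' _)

    entry : ∀ {τ} → τ ∈ D' → Tet τ × (∀ {u} → u ∈ τ → InV (suc m) u)
    entry {τ} p with ∈-++⁻ (diff D (B ++ negF B)) p
    ... | inj₁ q = let r , _ = ∈-diff⁻ D (B ++ negF B) q in All.lookup tets r , InV-suc ∘ vertices r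
    ... | inj₂ q with ∈-++⁻ (joinV (bd B) v) q
    ... | inj₁ r with ∈-map⁻ (v ∷_) r
    ... | t , t∈ , refl = let tri , b = bd-sound tetsB t∈ in v-unique tri b , λ where
      (here refl) → suc m , s≤s z≤n , ℕₚ.≤-refl , inj₁ refl
      (there u∈) → InV-suc (boundary-vertex b u∈)
    entry p | inj₂ q | inj₂ r with ∈-map⁻ (ℤ.- v ∷_) r
    ... | t , t∈ , refl with bd-sound (negF-tets tetsB) t∈
    ... | tri , b = (∉⇒unique-∷ (¬InV-neg ∘ vert) (proj₁ tri) , cong suc (proj₂ tri)) ,
        (λ { (here refl) → suc m , s≤s z≤n , ℕₚ.≤-refl , inj₂ refl ; (there u∈) → InV-suc (vert u∈) })
      where
      vert : ∀ {u} → u ∈ t → InV m u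
      vert u∈ = negS-vertex (negF-Bd⁻ b) (subst (_ ∈_) (sym (negS-negS t)) u∈)

    swap-edge : ∀ {u w} → Face D' (u ∷ w ∷ []) → Face D' (w ∷ u ∷ [])
    swap-edge = face⊆ (∷-⊆ (there (here refl)) (∷-⊆ (here refl) λ ()))

    edge⁺ : ∀ {u} → InV m u → Face D' (v ∷ u ∷ [])
    edge⁺ i = let F , F∈ , u∈ = find (cover i) in
      up (ConeSphere.small C₂ ℕₚ.≤-refl (ConeSphere.edge C₁ (Permₚ.∈-resp-↭ (↭-sym S↭B) F∈) u∈))

    edge⁻ : ∀ {u} → InV m u → Face D' (ℤ.- v ∷ u ∷ [])
    edge⁻ {u} i = let F , F∈ , u∈ = find (cover (InV-neg i)) in
      up (ConeSphere.edge C₂ (∈-map⁺ negS (Permₚ.∈-resp-↭ (↭-sym S↭B) F∈))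
        (subst (_∈ negS F) (ℤₚ.neg-involutive u) (∈-negS u∈)))

    -- Supplies a neighbor of the new vertex, from whose edge the degenerate pairs {v, v} in
    -- `edges'` follow.
    one : InV m (+ 1)
    one = 1 , s≤s z≤n , 1≤m , inj₁ refl

    edges' : ∀ {u w} → InV (suc m) u → InV (suc m) w → u ≢ ℤ.- w → Face D' (u ∷ w ∷ [])
    edges' i j ne with InV-suc⁻ i | InV-suc⁻ j
    ... | inj₁ i' | inj₁ j' = up (ConeSphere.small C₂ ℕₚ.≤-refl (ConeSphere.small C₁ ℕₚ.≤-refl (edges i' j' ne)))
    ... | inj₂ (inj₁ refl) | inj₁ j' = edge⁺ j'
    ... | inj₂ (inj₂ refl) | inj₁ j' = edge⁻ j'
    ... | inj₁ i' | inj₂ (inj₁ refl) = swap-edge (edge⁺ i')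
    ... | inj₁ i' | inj₂ (inj₂ refl) = swap-edge (edge⁻ i')
    ... | inj₂ (inj₁ refl) | inj₂ (inj₁ refl) = face⊆ (∷-⊆ (here refl) (∷-⊆ (here refl) λ ())) (edge⁺ one)
    ... | inj₂ (inj₂ refl) | inj₂ (inj₂ refl) = face⊆ (∷-⊆ (here refl) (∷-⊆ (here refl) λ ())) (edge⁻ one)
    ... | inj₂ (inj₁ refl) | inj₂ (inj₂ refl) = ⊥-elim (ne refl)
    ... | inj₂ (inj₂ refl) | inj₂ (inj₁ refl) = ⊥-elim (ne refl)

    symmetric' : CentrallySymmetric D'
    symmetric' ρ f = replace-complete {D} tetsB distB (aux (replace-sound {D} tetsB f))
      where
      aux : ReplacedFace D B v ρ → ReplacedFace D B v (negS ρ)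
      aux (new tri b s) = neg tri b (negS-⊆ s)
      aux (neg tri b s) = new tri b (subst (λ t → negS ρ ⊆ v ∷ t) (negS-negS _) (negS-⊆ s))
      aux (old {τ} τ∈ n k s) with ≋face (negS-tet (All.lookup tets τ∈)) (symmetric τ (face-refl τ∈))
      ... | τ' , τ'∈ , e = old τ'∈ (k ∘ Any-negF⁺ ∘ Any-≋ (≋-sym e)) (n ∘ Any-negF⁻ ∘ Any-≋ (≋-sym e))
        (proj₁ e ∘ negS-⊆ s)

  replaced : Sphere (suc m) (replace D B (+ suc m))
  replaced = record
    { tets = All.tabulate (proj₁ ∘ entry)
    ; pm = λ tri u fx fy fz → ConeSphere.pm C₂ tri u (down fx) (down fy) (down fz)
    ; sphere = Eq.symmetric Step (≈F⇒equivalent D₂≈D') ◅◅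
        Eq.symmetric Step (ConeSphere.equivalent C₁ ◅◅ ConeSphere.equivalent C₂) ◅◅ sphere
    ; symmetric = symmetric'
    ; vertices = λ τ∈ → proj₂ (entry τ∈)
    ; edges = edges'
    }

  replaced-old : ∀ {F} → Tet F → Face D F → ¬ Any (F ≋_) B → ¬ Any (F ≋_) (negF B) → Face (replace D B (+ suc m)) F
  replaced-old tF f n k with ≋face tF f
  ... | τ , τ∈ , e = replace-complete {D} tetsB distB
    (old τ∈ (n ∘ Any-≋ (≋-sym e)) (k ∘ Any-≋ (≋-sym e)) (proj₁ e))

  replaced-new : ∀ {t} → Tri t → Bd B t → Face (replace D B (+ suc m)) (+ suc m ∷ t)
  replaced-new tri b = replace-complete {D} tetsB distB (new tri b id)

  replaced-neg : ∀ {t} → Tri t → Bd B t → Face (replace D B (+ suc m)) (ℤ.- (+ suc m) ∷ negS t)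
  replaced-neg tri b = replace-complete {D} tetsB distB (neg tri b id)

-- The 4-dimensional cross-polytope.

face? : ∀ K ρ → Dec (Face K ρ)
face? K ρ = Any.any? (ρ ⊆?_) K

-- The only minimal non-face at the start is {0, 1, 2, 3, 4}. Starring {0, ..., k-1} with -k splits
-- {0, ..., k} into the non-faces {0, ..., k-1} and {k, -k}. The last step, at the vertex 0, just
-- renames 0 to -1.
cross₀ cross₁ cross₂ cross₃ cross₄ : FacetList
cross₀ = simplexBoundary 3
cross₁ = stellar cross₀ (+ 0 ∷ + 1 ∷ + 2 ∷ + 3 ∷ []) (ℤ.- + 4)
cross₂ = stellar cross₁ (+ 0 ∷ + 1 ∷ + 2 ∷ []) (ℤ.- + 3)
cross₃ = stellar cross₂ (+ 0 ∷ + 1 ∷ []) (ℤ.- + 2)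
cross₄ = stellar cross₃ (+ 0 ∷ []) (ℤ.- + 1)

≈F-check : ∀ K L → All (Face L) K → All (Face K) L → K ≈F L
≈F-check K L p q ρ = mk⇔ (aux p) (aux q)
  where
  aux : ∀ {K L} → All (Face L) K → Face K ρ → Face L ρ
  aux p f = let τ , τ∈ , s = find f in face⊆ s (All.lookup p τ∈)

stellar-equivalent : ∀ K x σ w {_ : True (face? K (x ∷ σ))} {_ : False (face? K [ w ])} →
  StellarEquivalent K (stellar K (x ∷ σ) w)
stellar-equivalent K x σ w {f} {n} =
  fwd (stellar-step (λ ()) (toWitness f) (toWitnessFalse n) λ _ → mk⇔ id id) ◅ ε

crossC≈cross₄ : crossC 4 ≈F cross₄
crossC≈cross₄ = ≈F-check _ _ (toWitness {a? = All.all? (face? cross₄) (crossC 4)} tt)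
  (toWitness {a? = All.all? (face? (crossC 4)) cross₄} tt)

crossC-sphere : CombinatorialSphere 3 (crossC 4)
crossC-sphere = ≈F⇒equivalent crossC≈cross₄ ◅◅ Eq.symmetric Step
  (stellar-equivalent cross₀ (+ 0) (+ 1 ∷ + 2 ∷ + 3 ∷ []) (ℤ.- + 4) ◅◅
   stellar-equivalent cross₁ (+ 0) (+ 1 ∷ + 2 ∷ []) (ℤ.- + 3) ◅◅
   stellar-equivalent cross₂ (+ 0) (+ 1 ∷ []) (ℤ.- + 2) ◅◅
   stellar-equivalent cross₃ (+ 0) [] (ℤ.- + 1))

V₄ : List ℤ
V₄ = + 1 ∷ + 2 ∷ + 3 ∷ + 4 ∷ -[1+ 0 ] ∷ -[1+ 1 ] ∷ -[1+ 2 ] ∷ -[1+ 3 ] ∷ []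

crossC-tets : All Tet (crossC 4)
crossC-tets = toWitness {a? = All.all? (λ τ → unique? τ ×-dec (length τ ℕ.≟ 4)) (crossC 4)} tt

crossC-full : All (λ A → All (λ B → All (λ x → x ∈ B ⊎ ℤ.- x ∈ B) A) (crossC 4)) (crossC 4)
crossC-full = toWitness {a? = All.all? (λ A → All.all? (λ B → All.all? (λ x → (x ∈? B) ⊎-dec (ℤ.- x ∈? B)) A) (crossC 4)) (crossC 4)} tt

crossC-proper : All (λ A → All (λ x → ℤ.- x ∉ A) A) (crossC 4)
crossC-proper = toWitness {a? = All.all? (λ A → All.all? (λ x → ¬? (ℤ.- x ∈? A)) A) (crossC 4)} tt

-- Any facet contains x or -x, so a facet y∷t adjacent to x∷t has y ≡ -x.
crossC-pseudomanifold : Pseudomanifold (crossC 4)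
crossC-pseudomanifold {t} {x} {y} {z} tri ((x≢y ∷ x≢z ∷ x≢t) ∷ (y≢z ∷ y≢t) ∷ z≢t ∷ _) fx fy fz =
  y≢z (trans (sym (opposite x≢y y≢t fy)) (opposite x≢z z≢t fz))
  where
  opposite : ∀ {y} → x ≢ y → All (y ≢_) t → Face (crossC 4) (y ∷ t) → ℤ.- x ≡ y
  opposite {y} x≢y y≢t fy with find fx | find fy
  ... | A , A∈ , sA | B , B∈ , sB = aux (All.lookup (All.lookup (All.lookup crossC-full A∈) B∈) (sA (here refl)))
    where
    B⊆ : B ⊆ y ∷ t
    B⊆ = unique-⊆-full (y≢t ∷ proj₁ tri) sB
      (ℕₚ.≤-reflexive (trans (proj₂ (All.lookup crossC-tets B∈)) (cong suc (sym (proj₂ tri)))))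
    aux : x ∈ B ⊎ ℤ.- x ∈ B → ℤ.- x ≡ y
    aux (inj₁ p) with B⊆ p
    ... | here e = ⊥-elim (x≢y e)
    ... | there q = ⊥-elim (All.lookup x≢t q refl)
    aux (inj₂ p) with B⊆ p
    ... | here e = e
    ... | there q = ⊥-elim (All.lookup (All.lookup crossC-proper A∈) (sA (here refl)) (sA (there q)))

InV₄⇒∈ : ∀ {v} → InV 4 v → v ∈ V₄
InV₄⇒∈ (0 , () , _)
InV₄⇒∈ (1 , _ , _ , inj₁ refl) = toWitness {a? = + 1 ∈? V₄} tt
InV₄⇒∈ (2 , _ , _ , inj₁ refl) = toWitness {a? = + 2 ∈? V₄} tt
InV₄⇒∈ (3 , _ , _ , inj₁ refl) = toWitness {a? = + 3 ∈? V₄} tt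
InV₄⇒∈ (4 , _ , _ , inj₁ refl) = toWitness {a? = + 4 ∈? V₄} tt
InV₄⇒∈ (1 , _ , _ , inj₂ refl) = toWitness {a? = -[1+ 0 ] ∈? V₄} tt
InV₄⇒∈ (2 , _ , _ , inj₂ refl) = toWitness {a? = -[1+ 1 ] ∈? V₄} tt
InV₄⇒∈ (3 , _ , _ , inj₂ refl) = toWitness {a? = -[1+ 2 ] ∈? V₄} tt
InV₄⇒∈ (4 , _ , _ , inj₂ refl) = toWitness {a? = -[1+ 3 ] ∈? V₄} tt
InV₄⇒∈ (suc (suc (suc (suc (suc _)))) , _ , s≤s (s≤s (s≤s (s≤s ()))) , _)

V₄-InV : All (InV 4) V₄
V₄-InV = pos 1 ∷ pos 2 ∷ pos 3 ∷ pos 4 ∷ InV-neg (pos 1) ∷ InV-neg (pos 2) ∷ InV-neg (pos 3) ∷ InV-neg (pos 4) ∷ []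
  where
  pos : ∀ k {_ : True (1 ℕ.≤? k)} {_ : True (k ℕ.≤? 4)} → InV 4 (+ k)
  pos k {p} {q} = k , toWitness p , toWitness q , inj₁ refl

crossC-Sphere : Sphere 4 (crossC 4)
crossC-Sphere = record
  { tets = crossC-tets
  ; pm = crossC-pseudomanifold
  ; sphere = crossC-sphere
  ; symmetric = λ σ f → let τ , τ∈ , s = find f in face⊆ (negS-⊆ s)
      (All.lookup (toWitness {a? = All.all? (λ τ → face? (crossC 4) (negS τ)) (crossC 4)} tt) τ∈)
  ; vertices = λ τ∈ v∈ → All.lookup V₄-InV
      (All.lookup (All.lookup (toWitness {a? = All.all? (All.all? (_∈? V₄)) (crossC 4)} tt) τ∈) v∈)
  ; edges = λ i j n → [ (λ e → ⊥-elim (n e)) , id ]′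
      (All.lookup (All.lookup (toWitness {a? = All.all? (λ u → All.all? (λ v →
        (u ℤ.≟ ℤ.- v) ⊎-dec face? (crossC 4) (u ∷ v ∷ [])) V₄) V₄} tt) (InV₄⇒∈ i)) (InV₄⇒∈ j))
  }

-- An invariant separating a ball from its antipode.

data Oriented (F : Simplex) : Set where
  positive : ∀ {x} → x ∈ F → (∀ {x} → x ∈ F → ∃ λ a → x ≡ + suc a) → Oriented F
  through1 : + 1 ∈ F → -[1+ 0 ] ∉ F → + 2 ∉ F → Oriented F
  top      : ∀ {a} → + suc a ∈ F → (∀ {b} → -[1+ b ] ∈ F → b < a) → (-[1+ 0 ] ∈ F → -[1+ 1 ] ∈ F) → Oriented F

-- Each kind has a positive vertex, so a positive simplex is not the antipode of any. For `through1`
-- against `top`, 1 in F puts -1, hence -2, in G and so 2 in F. For two `top` simplices each chosen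
-- positive vertex would be smaller than the other.
oriented-disjoint : ∀ {F G} → Oriented F → Oriented G → ¬ (F ≋ negS G)
oriented-disjoint {F} {G} oF oG (p , q) = aux oF oG ∈G ∈F
  where
  ∈F : ∀ {x} → x ∈ G → ℤ.- x ∈ F
  ∈F = q ∘ ∈-negS
  ∈G : ∀ {x} → x ∈ F → ℤ.- x ∈ G
  ∈G {x} x∈ = ∈-negS⁻ (subst (_∈ negS G) (sym (ℤₚ.neg-involutive x)) (p x∈))
  not-positive : ∀ {a} {F : Simplex} → (∀ {x} → x ∈ F → ∃ λ a → x ≡ + suc a) → -[1+ a ] ∉ F
  not-positive f x∈ with f x∈
  ... | _ , ()
  aux : ∀ {F G} → Oriented F → Oriented G → (∀ {x} → x ∈ F → ℤ.- x ∈ G) → (∀ {x} → x ∈ G → ℤ.- x ∈ F) → ⊥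
  aux (positive x∈ f) (positive _ g) ∈G _ with f x∈
  ... | _ , refl = not-positive g (∈G x∈)
  aux (positive _ f) (through1 y _ _) _ ∈F = not-positive f (∈F y)
  aux (positive _ f) (top y _ _) _ ∈F = not-positive f (∈F y)
  aux (through1 x _ _) (positive _ g) ∈G _ = not-positive g (∈G x)
  aux (top x _ _) (positive _ g) ∈G _ = not-positive g (∈G x)
  aux (through1 x _ _) (through1 _ n _) ∈G _ = n (∈G x)
  aux (through1 x _ n) (top _ _ h) ∈G ∈F = n (∈F (h (∈G x)))
  aux (top _ _ h) (through1 y _ n) ∈G ∈F = n (∈G (h (∈F y)))
  aux (top x f _) (top y g _) ∈G ∈F = ℕₚ.<-asym (f (∈F y)) (g (∈G x))

tet : ∀ {a b c d : ℤ} → a ≢ b → a ≢ c → a ≢ d → b ≢ c → b ≢ d → c ≢ d → Tet (a ∷ b ∷ c ∷ d ∷ [])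
tet ab ac ad bc bd cd = ((ab ∷ ac ∷ ad ∷ []) ∷ (bc ∷ bd ∷ []) ∷ (cd ∷ []) ∷ [] ∷ []) , refl

tri3 : ∀ {a b c : ℤ} → a ≢ b → a ≢ c → b ≢ c → Tri (a ∷ b ∷ c ∷ [])
tri3 ab ac bc = ((ab ∷ ac ∷ []) ∷ (bc ∷ []) ∷ [] ∷ []) , refl

-≢ : ∀ {a b} → a < b → -[1+ a ] ≢ -[1+ b ]
-≢ l refl = ℕₚ.<⇒≱ l ℕₚ.≤-refl

none : ∀ {x a b c d : ℤ} → x ≢ a → x ≢ b → x ≢ c → x ≢ d → x ∉ a ∷ b ∷ c ∷ d ∷ []
none xa xb xc xd (here e) = xa e
none xa xb xc xd (there (here e)) = xb e
none xa xb xc xd (there (there (here e))) = xc e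
none xa xb xc xd (there (there (there (here e)))) = xd e

-- The ball B^{3,1}_n for n = 3 + j: the join of the edge {n, n-1} with the path
-- -1, ..., -(n-2), 1, ..., n-2, and two more facets.

posE negE : ℕ → Simplex
posE i = + suc i ∷ + suc (suc i) ∷ []
negE i = -[1+ i ] ∷ -[1+ suc i ] ∷ []

midE : ℕ → Simplex
midE j = -[1+ j ] ∷ + 1 ∷ []

data Edge (j : ℕ) : Simplex → Set where
  pos : ∀ {i} → i < j → Edge j (posE i)
  mid : Edge j (midE j)
  neg : ∀ {i} → i < j → Edge j (negE i)

edge-unique : ∀ {j e} → Edge j e → Unique e
edge-unique (pos _) = ((λ ()) ∷ []) ∷ [] ∷ []
edge-unique mid = ((λ ()) ∷ []) ∷ [] ∷ []
edge-unique (neg _) = ((λ ()) ∷ []) ∷ [] ∷ []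

edge-length : ∀ {j e} → Edge j e → length e ≡ 2
edge-length (pos _) = refl
edge-length mid = refl
edge-length (neg _) = refl

edge-bound : ∀ {j e x} → Edge j e → x ∈ e → ℤ.∣ x ∣ ≤ suc j
edge-bound (pos i<j) (here refl) = s≤s (ℕₚ.<⇒≤ i<j)
edge-bound (pos i<j) (there (here refl)) = s≤s i<j
edge-bound mid (here refl) = ℕₚ.≤-refl
edge-bound mid (there (here refl)) = s≤s z≤n
edge-bound (neg i<j) (here refl) = s≤s (ℕₚ.<⇒≤ i<j)
edge-bound (neg i<j) (there (here refl)) = s≤s i<j

pathEdges-++ : ∀ (h : ℕ → ℤ) k c ys → pathEdges (applyUpTo h (suc k) ++ c ∷ ys) ≡
  applyUpTo (λ i → h i ∷ h (suc i) ∷ []) k ++ (h k ∷ c ∷ []) ∷ pathEdges (c ∷ ys)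
pathEdges-++ h zero c ys = refl
pathEdges-++ h (suc k) c ys = cong (_ ∷_) (pathEdges-++ (h ∘ suc) k c ys)

cycle-explicit : ∀ k → cycle (suc k) ≡
  applyUpTo posE k ++ (+ suc k ∷ -[1+ 0 ] ∷ []) ∷ applyUpTo negE k ++ (-[1+ k ] ∷ + 1 ∷ []) ∷ []
cycle-explicit k = trans
  (cong₂ (λ p q → pathEdges (p ++ q ++ [ + 1 ]))
    (Listₚ.map-applyUpTo (λ i → 1 + i) (λ i → + i) (suc k))
    (Listₚ.map-applyUpTo (λ i → 1 + i) (λ i → ℤ.- (+ i)) (suc k)))
  (trans (pathEdges-++ (λ i → + suc i) k _ _)
    (cong (λ l → applyUpTo posE k ++ (+ suc k ∷ -[1+ 0 ] ∷ []) ∷ l) (pathEdges-++ -[1+_] k _ _)))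

diff-++ : ∀ F F' G → diff (F ++ F') G ≡ diff F G ++ diff F' G
diff-++ F F' G = Listₚ.filter-++ _ F F'

diff-all : ∀ F {G} → (∀ {σ} → σ ∈ F → ¬ Any (σ ≋_) G) → diff F G ≡ F
diff-all F {G} f = Listₚ.filter-all _ (All.tabulate λ p → proj₂ (∈-filter⁻ (λ σ → T? (not (σ ∈Fᵇ G))) {xs = F} (∈-diff⁺ p (f p))))

diff-drop : ∀ σ F {G} → Any (σ ≋_) G → diff (σ ∷ F) G ≡ diff F G
diff-drop σ F {G} a with σ ∈Fᵇ G | Any⇒∈Fᵇ {σ} {G} a
... | true | _ = refl

-- The cycle on n = j + 2 loses the edge {n, -1}, which it lists with the vertices in the opposite
-- order from `G`; the rest is a path.
B11 : ∀ j → B 1 1 (2 + j) ≡ applyUpTo posE (suc j) ++ applyUpTo negE (suc j) ++ midE (suc j) ∷ []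
B11 j = trans (cong (λ l → diff l G) (cycle-explicit (suc j)))
  (trans (diff-++ (applyUpTo posE (suc j)) (κ ∷ rest) G)
    (cong₂ _++_ (diff-all (applyUpTo posE (suc j)) pos∉)
      (trans (diff-drop κ rest {G} (here ((λ { (here e) → there (here e) ; (there (here e)) → here e }) ,
                                      (λ { (here e) → there (here e) ; (there (here e)) → here e }))))
        (diff-all rest rest∉))))
  where
  G = (-[1+ 0 ] ∷ + (2 + j) ∷ []) ∷ []
  κ = + (2 + j) ∷ -[1+ 0 ] ∷ []
  rest = applyUpTo negE (suc j) ++ midE (suc j) ∷ []
  pos∉ : ∀ {σ} → σ ∈ applyUpTo posE (suc j) → ¬ Any (σ ≋_) G
  pos∉ σ∈ (here (_ , q)) with ∈-applyUpTo⁻ posE σ∈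
  ... | i , _ , refl with q (here refl)
  ... | here ()
  ... | there (here ())
  rest∉ : ∀ {σ} → σ ∈ rest → ¬ Any (σ ≋_) G
  rest∉ σ∈ (here (_ , q)) with ∈-++⁻ (applyUpTo negE (suc j)) σ∈
  rest∉ σ∈ (here (_ , q)) | inj₁ p with ∈-applyUpTo⁻ negE p
  ... | i , _ , refl with q (there (here refl))
  ... | here ()
  ... | there (here ())
  rest∉ σ∈ (here (_ , q)) | inj₂ (here refl) with q (there (here refl))
  ... | here ()
  ... | there (here ())

joinE : ℕ → Simplex → Simplex
joinE j e = + (3 + j) ∷ + (2 + j) ∷ e

-- The negative halves of the recursion: `X₁` is -B^{1,0}_{n-2} joined with -(n-1) and n, and `X₂`
-- is -B^{2,0}_{n-1} joined with -n.
X₁ X₂ : ℕ → Simplex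
X₁ j = + (3 + j) ∷ -[1+ suc j ] ∷ + 1 ∷ -[1+ j ] ∷ []
X₂ j = -[1+ 2 + j ] ∷ -[1+ suc j ] ∷ + 1 ∷ -[1+ j ] ∷ []

data InBall (j : ℕ) : Simplex → Set where
  join : ∀ {e} → Edge j e → InBall j (joinE j e)
  x₁ : InBall j (X₁ j)
  x₂ : InBall j (X₂ j)

edges : ℕ → FacetList
edges j = applyUpTo posE j ++ applyUpTo negE j ++ midE j ∷ []

ball : ℕ → FacetList
ball j = map (joinE j) (edges j) ++ X₁ j ∷ X₂ j ∷ []

B31 : ∀ j → B 3 1 (4 + j) ≡ ball (suc j)
B31 j = trans (cong (λ l → joinV (joinV l (+ (3 + j)) ++ (-[1+ 2 + j ] ∷ + 1 ∷ -[1+ suc j ] ∷ []) ∷ []) (+ (4 + j)) ++ X₂ (suc j) ∷ []) (B11 j))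
  (trans (cong (_++ X₂ (suc j) ∷ []) (trans (Listₚ.map-++ _ (joinV (edges (suc j)) (+ (3 + j))) _)
     (cong (_++ X₁ (suc j) ∷ []) (sym (Listₚ.map-∘ (edges (suc j)))))))
   (Listₚ.++-assoc (map (joinE (suc j)) (edges (suc j))) (X₁ (suc j) ∷ []) _))

∈-edges⁻ : ∀ {j e} → e ∈ edges j → Edge j e
∈-edges⁻ {j} p with ∈-++⁻ (applyUpTo posE j) p
∈-edges⁻ p | inj₁ q with ∈-applyUpTo⁻ posE q
... | i , i< , refl = pos i<
∈-edges⁻ {j} p | inj₂ q with ∈-++⁻ (applyUpTo negE j) q
... | inj₂ (here refl) = mid
... | inj₁ r with ∈-applyUpTo⁻ negE r
... | i , i< , refl = neg i<

∈-edges⁺ : ∀ {j e} → Edge j e → e ∈ edges j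
∈-edges⁺ (pos i<) = ∈-++⁺ˡ (∈-applyUpTo⁺ posE i<)
∈-edges⁺ {j} mid = ∈-++⁺ʳ (applyUpTo posE j) (∈-++⁺ʳ (applyUpTo negE j) (here refl))
∈-edges⁺ {j} (neg i<) = ∈-++⁺ʳ (applyUpTo posE j) (∈-++⁺ˡ (∈-applyUpTo⁺ negE i<))

∈-ball⁻ : ∀ {j F} → F ∈ ball j → InBall j F
∈-ball⁻ {j} p with ∈-++⁻ (map (joinE j) (edges j)) p
... | inj₂ (here refl) = x₁
... | inj₂ (there (here refl)) = x₂
... | inj₁ q with ∈-map⁻ (joinE j) q
... | e , e∈ , refl = join (∈-edges⁻ e∈)

∈-ball⁺ : ∀ {j F} → InBall j F → F ∈ ball j
∈-ball⁺ {j} (join e) = ∈-++⁺ˡ (∈-map⁺ (joinE j) (∈-edges⁺ e))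
∈-ball⁺ {j} x₁ = ∈-++⁺ʳ (map (joinE j) (edges j)) (here refl)
∈-ball⁺ {j} x₂ = ∈-++⁺ʳ (map (joinE j) (edges j)) (there (here refl))

bound-∉ : ∀ {j e x} → Edge j e → suc j < ℤ.∣ x ∣ → x ∉ e
bound-∉ ed l x∈ = ℕₚ.<⇒≱ l (edge-bound ed x∈)

ball-tet : ∀ {j F} → InBall j F → Tet F
ball-tet {j} (join {e} ed) =
  (∉⇒unique-∷ n∉ (∉⇒unique-∷ (bound-∉ ed ℕₚ.≤-refl) (edge-unique ed))) , cong (λ k → 2 + k) (edge-length ed)
  where
  n∉ : + (3 + j) ∉ + (2 + j) ∷ e
  n∉ (here ())
  n∉ (there p) = bound-∉ ed (ℕₚ.n≤1+n _) p
ball-tet x₁ = tet (λ ()) (λ ()) (λ ()) (λ ()) (λ ()) (λ ())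
ball-tet x₂ = tet (λ ()) (λ ()) (λ ()) (λ ()) (λ ()) (λ ())

-- The index `suc j` means n ≥ 4, which keeps n - 1 different from 2 and -(n-2) different from -1.
ball-oriented : ∀ {j F} → InBall (suc j) F → Oriented F
ball-oriented (join (pos _)) = positive (here refl) λ where
  (here refl) → _ , refl
  (there (here refl)) → _ , refl
  (there (there (here refl))) → _ , refl
  (there (there (there (here refl)))) → _ , refl
ball-oriented (join mid) = through1 (there (there (there (here refl))))
  (none (λ ()) (λ ()) (λ ()) (λ ()))
  (none (λ ()) (λ ()) (λ ()) (λ ()))
ball-oriented (join (neg i<j)) = top (here refl)
  (λ { (there (there (here refl))) → ℕₚ.<-trans i<j (s≤s (ℕₚ.n≤1+n _))
     ; (there (there (there (here refl)))) → s≤s (ℕₚ.≤-trans i<j (ℕₚ.n≤1+n _)) })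
  (λ { (there (there (here refl))) → there (there (there (here refl)))
     ; (there (there (there (here ())))) })
ball-oriented x₁ = through1 (there (there (here refl)))
  (none (λ ()) (λ ()) (λ ()) (λ ()))
  (none (λ ()) (λ ()) (λ ()) (λ ()))
ball-oriented x₂ = through1 (there (there (here refl)))
  (none (λ ()) (λ ()) (λ ()) (λ ()))
  (none (λ ()) (λ ()) (λ ()) (λ ()))

ball-cover : ∀ {j v} → InV (4 + j) v → Any (v ∈_) (ball (suc j))
ball-cover {j} (suc k , _ , s≤s k≤ , e) with k ℕ.≤? suc j | e
... | yes l | _ with k ℕ.≟ suc j | e
ball-cover _ | yes l | _ | yes refl | inj₁ refl = lose (∈-ball⁺ (join (pos ℕₚ.≤-refl))) (there (there (there (here refl))))
ball-cover _ | yes l | _ | yes refl | inj₂ refl = lose (∈-ball⁺ (join (neg ℕₚ.≤-refl))) (there (there (there (here refl))))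
ball-cover _ | yes l | _ | no n | inj₁ refl = lose (∈-ball⁺ (join (pos (ℕₚ.≤∧≢⇒< l n)))) (there (there (here refl)))
ball-cover _ | yes l | _ | no n | inj₂ refl = lose (∈-ball⁺ (join (neg (ℕₚ.≤∧≢⇒< l n)))) (there (there (here refl)))
ball-cover {j} (suc k , _ , s≤s k≤ , _) | no n | e with k ℕ.≟ 2 + j | e
... | yes refl | inj₁ refl = lose (∈-ball⁺ (join mid)) (there (here refl))
... | yes refl | inj₂ refl = lose (∈-ball⁺ {suc j} x₂) (there (here refl))
... | no m | e' with ℕₚ.≤-antisym k≤ (ℕₚ.≤∧≢⇒< (ℕₚ.≰⇒> n) (m ∘ sym)) | e'
... | refl | inj₁ refl = lose (∈-ball⁺ (join mid)) (here refl)
... | refl | inj₂ refl = lose (∈-ball⁺ {suc j} x₂) (here refl)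

module _ (j : ℕ) where
  private
    J = suc j
    Jp Jn : ℕ → Simplex
    Jp = joinE J ∘ posE
    Jn = joinE J ∘ negE
    M = joinE J (midE J)

    Sn = applyDownFrom Jn
    Sp : ℕ → FacetList
    Sp i = applyDownFrom Jp i ++ M ∷ Sn J

  -- Read from the end, the order follows the path from -1 to n - 2, each edge bringing its next
  -- endpoint. Then `X₁` brings -(n-1), glued to the tetrahedron of the middle edge, and `X₂` brings
  -- -n, glued to `X₁`.
  stackedBall : FacetList
  stackedBall = X₂ J ∷ X₁ J ∷ Sp J

  private
    stacked-neg : ∀ i → i < J → Stacked (Sn (suc i))
    stacked-neg zero l = root (ball-tet (join (neg l)))
    stacked-neg (suc i) l = add (ball-tet (join (neg l))) (there (there (there (here refl)))) (here refl)
      (λ { (here e) → there (here e)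
         ; (there (here e)) → there (there (here e))
         ; (there (there (here e))) → there (there (there (there (here e))))
         ; (there (there (there (here e)))) → here e })
      (All.tabulate λ F∈ x∈ → aux F∈ x∈)
      (stacked-neg i (ℕₚ.<-trans (ℕₚ.n<1+n i) l))
      where
      aux : ∀ {F} → F ∈ Sn (suc i) → -[1+ suc (suc i) ] ∉ F
      aux F∈ x∈ with ∈-applyDownFrom⁻ Jn F∈
      ... | k , k< , refl with x∈
      ... | there (there (here refl)) = ℕₚ.<⇒≱ k< (ℕₚ.n≤1+n _)
      ... | there (there (there (here refl))) = ℕₚ.<⇒≱ k< ℕₚ.≤-refl

    stacked-mid : Stacked (M ∷ Sn J)
    stacked-mid = add (ball-tet {J} (join mid)) (there (there (there (here refl)))) (here refl)
      (λ { (here e) → there (here e)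
         ; (there (here e)) → there (there (here e))
         ; (there (there (here e))) → there (there (there (there (here e))))
         ; (there (there (there (here e)))) → here e })
      (All.tabulate λ F∈ x∈ → aux F∈ x∈)
      (stacked-neg j ℕₚ.≤-refl)
      where
      aux : ∀ {F} → F ∈ Sn J → + 1 ∉ F
      aux F∈ x∈ with ∈-applyDownFrom⁻ Jn F∈
      ... | k , k< , refl with x∈
      ... | here ()
      ... | there (there (there (there ())))

    stacked-pos : ∀ i → i ≤ J → Stacked (Sp i)
    stacked-pos zero _ = stacked-mid
    stacked-pos (suc i) l = add (ball-tet (join (pos l))) (there (there (there (here refl)))) (proj₁ (proj₂ (prev i)))
      (λ { (here e) → there (subst (_∈ _) (sym e) (proj₁ (proj₂ (proj₂ (prev i)))))
         ; (there (here e)) → there (subst (_∈ _) (sym e) (proj₁ (proj₂ (proj₂ (proj₂ (prev i))))))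
         ; (there (there (here e))) → there (subst (_∈ _) (sym e) (proj₂ (proj₂ (proj₂ (proj₂ (prev i))))))
         ; (there (there (there (here e)))) → here e })
      (All.tabulate λ F∈ x∈ → aux F∈ x∈)
      (stacked-pos i (ℕₚ.<⇒≤ l))
      where
      prev : ∀ i → ∃ λ G → G ∈ Sp i × (+ (3 + J) ∈ G) × (+ (2 + J) ∈ G) × (+ suc i ∈ G)
      prev zero = M , here refl , here refl , there (here refl) , there (there (there (here refl)))
      prev (suc i) = Jp i , here refl , here refl , there (here refl) , there (there (there (here refl)))
      aux : ∀ {F} → F ∈ Sp i → + suc (suc i) ∉ F
      aux F∈ x∈ with ∈-++⁻ (applyDownFrom Jp i) F∈
      aux F∈ x∈ | inj₂ (here refl) with x∈
      ... | here refl = ℕₚ.<⇒≱ l (ℕₚ.n≤1+n _)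
      ... | there (here refl) = ℕₚ.<⇒≱ l ℕₚ.≤-refl
      ... | there (there (there (here ())))
      aux F∈ x∈ | inj₂ (there F∈') with ∈-applyDownFrom⁻ Jn F∈'
      ... | k , k< , refl with x∈
      ... | here refl = ℕₚ.<⇒≱ l (ℕₚ.n≤1+n _)
      ... | there (here refl) = ℕₚ.<⇒≱ l ℕₚ.≤-refl
      ... | there (there (there (there ())))
      aux F∈ x∈ | inj₁ F∈' with ∈-applyDownFrom⁻ Jp F∈'
      ... | k , k< , refl with x∈
      ... | here refl = ℕₚ.<⇒≱ l (ℕₚ.n≤1+n _)
      ... | there (here refl) = ℕₚ.<⇒≱ l ℕₚ.≤-refl
      ... | there (there (here refl)) = ℕₚ.<⇒≱ k< (ℕₚ.n≤1+n _)
      ... | there (there (there (here refl))) = ℕₚ.<⇒≱ k< ℕₚ.≤-refl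

    Sp-entry : ∀ {F} → F ∈ Sp J → ∃ λ e → Edge J e × F ≡ joinE J e
    Sp-entry F∈ with ∈-++⁻ (applyDownFrom Jp J) F∈
    ... | inj₂ (here refl) = _ , mid , refl
    ... | inj₂ (there p) = let k , k< , e = ∈-applyDownFrom⁻ Jn p in _ , neg k< , e
    ... | inj₁ p = let k , k< , e = ∈-applyDownFrom⁻ Jp p in _ , pos k< , e

    large-∉ : ∀ {F k} → F ∈ Sp J → J < k → -[1+ k ] ∉ F
    large-∉ F∈ l x∈ with Sp-entry F∈
    ... | e , ed , refl with x∈
    ... | there (there p) = bound-∉ ed (s≤s l) p

  ball-stacked : Stacked stackedBall
  ball-stacked = add (ball-tet (x₂ {J})) (here refl) (here refl)
    (λ { (here e) → here e
       ; (there (here e)) → there (there (here e))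
       ; (there (there (here e))) → there (there (there (here e)))
       ; (there (there (there (here e)))) → there (there (there (there (here e)))) })
    (none (λ ()) (λ ()) (λ ()) (λ ()) ∷
     All.tabulate λ F∈ → large-∉ F∈ (s≤s (ℕₚ.n≤1+n _)))
    (add (ball-tet (x₁ {J})) (there (here refl)) (∈-++⁺ʳ (applyDownFrom Jp J) (here refl))
      (λ { (here e) → there (here e)
         ; (there (here e)) → here e
         ; (there (there (here e))) → there (there (there (there (here e))))
         ; (there (there (there (here e)))) → there (there (there (here e))) })
      (All.tabulate λ F∈ → large-∉ F∈ ℕₚ.≤-refl)
      (stacked-pos J ℕₚ.≤-refl))

  stackedBall↭ : stackedBall ↭ ball J
  stackedBall↭ = ↭-trans (Perm.swap _ _ (↭-trans body (Perm.↭-reflexive (sym explicit))))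
    (Permₚ.++-comm (X₁ J ∷ X₂ J ∷ []) (map (joinE J) (edges J)))
    where
    explicit : map (joinE J) (edges J) ≡ applyUpTo Jp J ++ applyUpTo Jn J ++ M ∷ []
    explicit = trans (Listₚ.map-++ (joinE J) (applyUpTo posE J) _)
      (cong₂ _++_ (Listₚ.map-applyUpTo posE (joinE J) J)
        (trans (Listₚ.map-++ (joinE J) (applyUpTo negE J) _)
          (cong (_++ M ∷ []) (Listₚ.map-applyUpTo negE (joinE J) J))))
    down↭up : ∀ (f : ℕ → Simplex) n → applyDownFrom f n ↭ applyUpTo f n
    down↭up f n = ↭-trans (Perm.↭-reflexive (sym (Listₚ.reverse-applyUpTo f n))) (Permₚ.↭-reverse _)
    body : Sp J ↭ applyUpTo Jp J ++ applyUpTo Jn J ++ M ∷ []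
    body = Permₚ.++⁺ (down↭up Jp J)
      (↭-trans (prep M (down↭up Jn J)) (Permₚ.++-comm (M ∷ []) (applyUpTo Jn J)))

-- Boundary triangles of the ball

module _ {j : ℕ} where
  joinE-unique : ∀ {e e'} → Edge j e → Edge j e' → e ⊆ joinE j e' → joinE j e' ≋ joinE j e
  joinE-unique {e} {e'} ed ed' s = ∷⁺ʳ _ (∷⁺ʳ _ full) , ∷⁺ʳ _ (∷⁺ʳ _ inner)
    where
    inner : e ⊆ e'
    inner x∈ with s x∈
    ... | here refl = ⊥-elim (bound-∉ ed (ℕₚ.n≤1+n _) x∈)
    ... | there (here refl) = ⊥-elim (bound-∉ ed ℕₚ.≤-refl x∈)
    ... | there (there p) = p
    full : e' ⊆ e
    full = unique-⊆-full (edge-unique ed) inner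
      (ℕₚ.≤-reflexive (trans (edge-length ed') (sym (edge-length ed))))

  -- Neither `X₁` nor `X₂` contains n - 1, so only the joins compete.
  Bd-lower : ∀ {e} → Edge j e → Bd (ball j) (+ (2 + j) ∷ e)
  Bd-lower {e} ed = joinE j e , ∈-ball⁺ (join ed) , there , λ G∈ → aux (∈-ball⁻ G∈)
    where
    aux : ∀ {G} → InBall j G → + (2 + j) ∷ e ⊆ G → G ≋ joinE j e
    aux x₁ s = ⊥-elim (none (λ ()) (λ ()) (λ ()) (λ ()) (s (here refl)))
    aux x₂ s = ⊥-elim (none (λ ()) (λ ()) (λ ()) (λ ()) (s (here refl)))
    aux (join ed') s = joinE-unique ed ed' (s ∘ there)

  -- `X₁` also contains n, and it contains the middle edge; the hypothesis excludes that edge.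
  Bd-upper : ∀ {e} → Edge j e → ¬ (e ⊆ X₁ j) → Bd (ball j) (+ (3 + j) ∷ e)
  Bd-upper {e} ed n = joinE j e , ∈-ball⁺ (join ed) , ∷⁺ʳ _ there , λ G∈ → aux (∈-ball⁻ G∈)
    where
    aux : ∀ {G} → InBall j G → + (3 + j) ∷ e ⊆ G → G ≋ joinE j e
    aux x₁ s = ⊥-elim (n (s ∘ there))
    aux x₂ s = ⊥-elim (none (λ ()) (λ ()) (λ ()) (λ ()) (s (here refl)))
    aux (join ed') s = joinE-unique ed ed' (s ∘ there)

  pos⊈X₁ : ∀ {i} → i < j → ¬ (posE i ⊆ X₁ j)
  pos⊈X₁ l s = none (λ { refl → ℕₚ.<⇒≱ l (ℕₚ.n≤1+n _) }) (λ ()) (λ ()) (λ ()) (s (there (here refl)))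

  neg⊈X₁ : ∀ {i} → i < j → ¬ (negE i ⊆ X₁ j)
  neg⊈X₁ l s = none (λ ()) (-≢ (ℕₚ.<-trans l (ℕₚ.n<1+n _))) (λ ()) (-≢ l) (s (here refl))

  -- The vertex -(n-1) rules out the joins, and n rules out `X₂`.
  Bd-X₁ : ∀ {t} → + (3 + j) ∈ t → -[1+ suc j ] ∈ t → t ⊆ X₁ j → Bd (ball j) t
  Bd-X₁ {t} n∈ m∈ s = X₁ j , ∈-ball⁺ {j} x₁ , s , λ G∈ → aux (∈-ball⁻ G∈)
    where
    aux : ∀ {G} → InBall j G → t ⊆ G → G ≋ X₁ j
    aux x₁ _ = ≋-refl
    aux x₂ q = ⊥-elim (none (λ ()) (λ ()) (λ ()) (λ ()) (q n∈))
    aux (join ed) q with q m∈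
    ... | there (there p) = ⊥-elim (bound-∉ ed ℕₚ.≤-refl p)

  Bd-X₂ : ∀ {t} → -[1+ 2 + j ] ∈ t → t ⊆ X₂ j → Bd (ball j) t
  Bd-X₂ {t} n∈ s = X₂ j , ∈-ball⁺ {j} x₂ , s , λ G∈ → aux (∈-ball⁻ G∈)
    where
    aux : ∀ {G} → InBall j G → t ⊆ G → G ≋ X₂ j
    aux x₂ _ = ≋-refl
    aux x₁ q = ⊥-elim (none (λ ()) (λ ()) (λ ()) (λ ()) (q n∈))
    aux (join ed) q with q n∈
    ... | there (there p) = ⊥-elim (bound-∉ ed (ℕₚ.n≤1+n _) p)

-- The endpoint n - 2 of the path lies on a single edge; `Bd-bottom` does the same at the endpoint
-- -1.
Bd-top : ∀ {j} → Bd (ball (suc j)) (+ (4 + j) ∷ + (3 + j) ∷ + (2 + j) ∷ [])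
Bd-top {j} = joinE (suc j) (posE j) , ∈-ball⁺ {suc j} (join (pos ℕₚ.≤-refl)) ,
  (λ { (here e) → here e ; (there (here e)) → there (here e) ; (there (there (here e))) → there (there (there (here e))) }) ,
  λ G∈ → aux (∈-ball⁻ G∈)
  where
  aux : ∀ {G} → InBall (suc j) G → + (4 + j) ∷ + (3 + j) ∷ + (2 + j) ∷ [] ⊆ G → G ≋ joinE (suc j) (posE j)
  aux x₁ s = ⊥-elim (none (λ ()) (λ ()) (λ ()) (λ ()) (s (there (here refl))))
  aux x₂ s = ⊥-elim (none (λ ()) (λ ()) (λ ()) (λ ()) (s (here refl)))
  aux (join mid) s = ⊥-elim (none (λ ()) (λ ()) (λ ()) (λ ()) (s (there (there (here refl)))))
  aux (join (neg l)) s = ⊥-elim (none (λ ()) (λ ()) (λ ()) (λ ()) (s (there (there (here refl)))))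
  aux (join (pos l)) s with s (there (there (here refl)))
  ... | there (there (here refl)) = ⊥-elim (ℕₚ.<⇒≱ l ℕₚ.≤-refl)
  ... | there (there (there (here refl))) = ≋-refl

Bd-bottom : ∀ {j} → Bd (ball (suc j)) (+ (4 + j) ∷ -[1+ 0 ] ∷ + (3 + j) ∷ [])
Bd-bottom {j} = joinE (suc j) (negE 0) , ∈-ball⁺ {suc j} (join (neg (s≤s z≤n))) ,
  (λ { (here e) → here e ; (there (here e)) → there (there (here e)) ; (there (there (here e))) → there (here e) }) ,
  λ G∈ → aux (∈-ball⁻ G∈)
  where
  aux : ∀ {G} → InBall (suc j) G → + (4 + j) ∷ -[1+ 0 ] ∷ + (3 + j) ∷ [] ⊆ G → G ≋ joinE (suc j) (negE 0)
  aux x₁ s = ⊥-elim (none (λ ()) (λ ()) (λ ()) (λ ()) (s (there (there (here refl)))))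
  aux x₂ s = ⊥-elim (none (λ ()) (λ ()) (λ ()) (λ ()) (s (here refl)))
  aux (join mid) s = ⊥-elim (none (λ ()) (λ ()) (λ ()) (λ ()) (s (there (here refl))))
  aux (join (pos l)) s = ⊥-elim (none (λ ()) (λ ()) (λ ()) (λ ()) (s (there (here refl))))
  aux (join (neg l)) s with s (there (here refl))
  ... | there (there (here refl)) = ≋-refl
  ... | there (there (there (there ())))

-- The facet {i+5, i+3} ∪ e appears in Δ^3_{i+5} and persists: facets removed in
-- passing from Δ^3_m to Δ^3_{m+1} have vertices of absolute value m and m-1.
record Stage (j : ℕ) (D : FacetList) : Set where
  field
    sphere : Sphere (4 + j) D
    ball⊂ : ∀ {F} → InBall (suc j) F → Face D F
    persistent : ∀ {i e} → Edge (suc i) e → i < j → Face D (+ (5 + i) ∷ + (3 + i) ∷ e)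

stage-zero : Stage 0 (crossC 4)
stage-zero = record
  { sphere = crossC-Sphere
  ; ball⊂ = λ b → All.lookup (toWitness {a? = All.all? (face? (crossC 4)) (ball 1)} tt) (∈-ball⁺ b)
  ; persistent = λ _ ()
  }

ball-indices : ∀ {j F} → InBall j F → (∃ λ x → x ∈ F × ℤ.∣ x ∣ ≡ 3 + j) × (∃ λ x → x ∈ F × ℤ.∣ x ∣ ≡ 2 + j)
ball-indices (join _) = (_ , here refl , refl) , (_ , there (here refl) , refl)
ball-indices x₁ = (_ , here refl , refl) , (_ , there (here refl) , refl)
ball-indices x₂ = (_ , here refl , refl) , (_ , there (here refl) , refl)

-- Only 5+i can reach the absolute value 4+j, and then 3+i is 2+j and e stays below it, so 3+j does
-- not occur.
persistent-indices : ∀ {i j e} → Edge (suc i) e → i < suc j →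
  (∃ λ x → x ∈ + (5 + i) ∷ + (3 + i) ∷ e × ℤ.∣ x ∣ ≡ 4 + j) →
  (∃ λ x → x ∈ + (5 + i) ∷ + (3 + i) ∷ e × ℤ.∣ x ∣ ≡ 3 + j) → ⊥
persistent-indices ed l (_ , there (here refl) , refl) _ = ℕₚ.<⇒≱ l ℕₚ.≤-refl
persistent-indices ed l (_ , there (there p) , e) _ = ℕₚ.<⇒≱ (ℕₚ.≤-trans (ℕₚ.≤-reflexive (sym e)) (edge-bound ed p)) (s≤s (s≤s (ℕₚ.≤-trans (ℕₚ.≤-pred l) (ℕₚ.n≤1+n _))))
persistent-indices ed l (_ , here refl , refl) (_ , there (there p) , e) =
  ℕₚ.<⇒≱ (ℕₚ.≤-trans (ℕₚ.≤-reflexive (sym e)) (edge-bound ed p)) (s≤s (s≤s (ℕₚ.n≤1+n _)))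
persistent-indices ed l (_ , here refl , refl) (_ , here refl , ())
persistent-indices ed l (_ , here refl , refl) (_ , there (here refl) , ())

-- With n = 4 + j, the tetrahedra of the next ball are cones over boundary triangles of the present
-- one: n with an edge common to both paths, {n, n-1, n-2} for the new positive edge, faces of `X₁`
-- for the middle and the new negative edge, and a face of `X₂` for the next `X₁`. Only the next
-- `X₂` has apex -(n+1): it is the antipode of the cone over {n, n-1, -1}.
stage-suc : ∀ {j D} → Stage j D → Stage (suc j) (replace D (ball (suc j)) (+ (5 + j)))
stage-suc {j} {D} st = record { sphere = replaced ; ball⊂ = ball⊂' ; persistent = persistent' }
  where
  open Stage st
  open Replacement sphere (s≤s z≤n) (stackedBall↭ j) (ball-stacked j) (ball⊂ ∘ ∈-ball⁻)
    (λ F∈ G∈ → oriented-disjoint (ball-oriented (∈-ball⁻ F∈)) (ball-oriented (∈-ball⁻ G∈))) ball-cover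
  D' = replace D (ball (suc j)) (+ (5 + j))

  edge-tri : ∀ {x e i} → Edge i e → suc i < ℤ.∣ x ∣ → Tri (x ∷ e)
  edge-tri ed l = ∉⇒unique-∷ (bound-∉ ed l) (edge-unique ed) , cong suc (edge-length ed)

  ball⊂' : ∀ {F} → InBall (2 + j) F → Face D' F
  ball⊂' (join (pos {i} l)) with i ℕ.≟ suc j
  ... | yes refl = replaced-new (tri3 (λ ()) (λ ()) (λ ())) Bd-top'
    where
    Bd-top' : Bd (ball (suc j)) (+ (4 + j) ∷ posE (suc j))
    Bd-top' = let F , F∈ , s , u = Bd-top {j} in F , F∈ , s ∘ swap23 , λ G∈ q → u G∈ (q ∘ swap23)
      where
      swap23 : ∀ {a b c : ℤ} → a ∷ b ∷ c ∷ [] ⊆ a ∷ c ∷ b ∷ []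
      swap23 (here e) = here e
      swap23 (there (here e)) = there (there (here e))
      swap23 (there (there (here e))) = there (here e)
  ... | no n = replaced-new (edge-tri (pos l') (ℕₚ.n≤1+n _)) (Bd-upper (pos l') (pos⊈X₁ l'))
    where
    l' : i < suc j
    l' = ℕₚ.≤∧≢⇒< (ℕₚ.≤-pred l) n
  ball⊂' (join mid) = replaced-new (tri3 (λ ()) (λ ()) (λ ()))
    (Bd-X₁ (here refl) (there (here refl)) λ where
      (here e) → here e
      (there (here e)) → there (here e)
      (there (there (here e))) → there (there (here e))
      (there (there (there ()))))
  ball⊂' (join (neg {i} l)) with i ℕ.≟ suc j
  ... | yes refl = replaced-new (tri3 (λ ()) (λ ()) (λ ()))
    (Bd-X₁ (here refl) (there (there (here refl))) λ where
      (here e) → here e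
      (there (here e)) → there (there (there (here e)))
      (there (there (here e))) → there (here e)
      (there (there (there ()))))
  ... | no n = replaced-new (edge-tri (neg l') (ℕₚ.n≤1+n _)) (Bd-upper (neg l') (neg⊈X₁ l'))
    where
    l' : i < suc j
    l' = ℕₚ.≤∧≢⇒< (ℕₚ.≤-pred l) n
  ball⊂' x₁ = replaced-new (tri3 (λ ()) (λ ()) (λ ()))
    (Bd-X₂ (here refl) λ where
      (here e) → here e
      (there (here e)) → there (there (here e))
      (there (there (here e))) → there (here e)
      (there (there (there ()))))
  ball⊂' x₂ = replaced-neg (tri3 (λ ()) (λ ()) (λ ())) Bd-bottom

  persistent' : ∀ {i e} → Edge (suc i) e → i < suc j → Face D' (+ (5 + i) ∷ + (3 + i) ∷ e)
  persistent' {i} {e} ed l with i ℕ.≟ j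
  -- This is where the facet arises: it is the cone from n+1 over n-1 joined with e.
  ... | yes refl = replaced-new (edge-tri ed ℕₚ.≤-refl) (Bd-lower ed)
  ... | no n = replaced-old tetF (persistent ed l')
      (λ a → let G , G∈ , _ , q = find a
                 (x , x∈ , ex) , (y , y∈ , ey) = ball-indices (∈-ball⁻ G∈)
             in persistent-indices ed l (x , q x∈ , ex) (y , q y∈ , ey))
      neg-case
    where
    l' : i < j
    l' = ℕₚ.≤∧≢⇒< (ℕₚ.≤-pred l) n
    tetF : Tet (+ (5 + i) ∷ + (3 + i) ∷ e)
    tetF = ∉⇒unique-∷ (λ { (there p) → bound-∉ ed (s≤s (s≤s (s≤s (ℕₚ.m≤n+m i 2)))) p }) (proj₁ (edge-tri ed ℕₚ.≤-refl)) ,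
      cong (λ k → 2 + k) (edge-length ed)
    neg-case : ¬ Any ((+ (5 + i) ∷ + (3 + i) ∷ e) ≋_) (negF (ball (suc j)))
    neg-case a with find a
    ... | G , G∈ , _ , q with ∈-map⁻ negS G∈
    ... | H , H∈ , refl with ball-indices (∈-ball⁻ H∈)
    ... | (x , x∈ , ex) , (y , y∈ , ey) = persistent-indices ed l
      (ℤ.- x , q (∈-negS x∈) , trans (ℤₚ.∣-i∣≡∣i∣ x) ex) (ℤ.- y , q (∈-negS y∈) , trans (ℤₚ.∣-i∣≡∣i∣ y) ey)

stage : ∀ j → Stage j (Δ 3 (4 + j))
stage zero = stage-zero
stage (suc j) = subst (λ b → Stage (suc j) (replace (Δ 3 (4 + j)) b (+ (5 + j)))) (sym (B31 j)) (stage-suc (stage j))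

-- The ball B(I) for n = 4 + j.

data InBI (j : ℕ) : Simplex → Set where
  p : ∀ {i} → i < j → InBI j (+ 1 ∷ + 2 ∷ + (3 + i) ∷ + (5 + i) ∷ [])
  r : InBI j (+ 1 ∷ + 2 ∷ + (3 + j) ∷ + (4 + j) ∷ [])
  a₁ : InBI j (+ 1 ∷ -[1+ suc j ] ∷ + (3 + j) ∷ + (4 + j) ∷ [])
  a₂ : InBI j (+ 1 ∷ -[1+ suc j ] ∷ -[1+ 2 + j ] ∷ + (4 + j) ∷ [])
  a₃ : InBI j (+ 1 ∷ -[1+ suc j ] ∷ -[1+ 2 + j ] ∷ -[1+ 3 + j ] ∷ [])
  q₀ : ∀ {k} → k ≤ j → InBI j (-[1+ k ] ∷ -[1+ suc k ] ∷ + (3 + j) ∷ + (4 + j) ∷ [])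
  c : ∀ {i} → i < j → InBI j (+ 1 ∷ -[1+ suc i ] ∷ + (3 + i) ∷ + (5 + i) ∷ [])
  q : ∀ {i k} → i < j → k ≤ i → InBI j (-[1+ k ] ∷ -[1+ suc k ] ∷ + (3 + i) ∷ + (5 + i) ∷ [])

BI-tet : ∀ {j F} → InBI j F → Tet F
BI-tet (p _) = tet (λ ()) (λ ()) (λ ()) (λ ()) (λ ()) (λ ())
BI-tet r = tet (λ ()) (λ ()) (λ ()) (λ ()) (λ ()) (λ ())
BI-tet a₁ = tet (λ ()) (λ ()) (λ ()) (λ ()) (λ ()) (λ ())
BI-tet a₂ = tet (λ ()) (λ ()) (λ ()) (λ ()) (λ ()) (λ ())
BI-tet a₃ = tet (λ ()) (λ ()) (λ ()) (λ ()) (λ ()) (λ ())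
BI-tet (q₀ _) = tet (λ ()) (λ ()) (λ ()) (λ ()) (λ ()) (λ ())
BI-tet (c _) = tet (λ ()) (λ ()) (λ ()) (λ ()) (λ ()) (λ ())
BI-tet (q _ _) = tet (λ ()) (λ ()) (λ ()) (λ ()) (λ ()) (λ ())

BI-oriented : ∀ {j F} → InBI j F → Oriented F
BI-oriented (p _) = positive (here refl) λ where
  (here refl) → _ , refl
  (there (here refl)) → _ , refl
  (there (there (here refl))) → _ , refl
  (there (there (there (here refl)))) → _ , refl
BI-oriented r = positive (here refl) λ where
  (here refl) → _ , refl
  (there (here refl)) → _ , refl
  (there (there (here refl))) → _ , refl
  (there (there (there (here refl)))) → _ , refl
BI-oriented a₁ = through1 (here refl) (none (λ ()) (λ ()) (λ ()) (λ ())) (none (λ ()) (λ ()) (λ ()) (λ ()))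
BI-oriented a₂ = through1 (here refl) (none (λ ()) (λ ()) (λ ()) (λ ())) (none (λ ()) (λ ()) (λ ()) (λ ()))
BI-oriented a₃ = through1 (here refl) (none (λ ()) (λ ()) (λ ()) (λ ())) (none (λ ()) (λ ()) (λ ()) (λ ()))
BI-oriented (c _) = through1 (here refl) (none (λ ()) (λ ()) (λ ()) (λ ())) (none (λ ()) (λ ()) (λ ()) (λ ()))
BI-oriented (q₀ l) = top (there (there (there (here refl))))
  (λ { (here refl) → s≤s (ℕₚ.≤-trans l (ℕₚ.m≤n+m _ 2))
     ; (there (here refl)) → s≤s (s≤s (ℕₚ.≤-trans l (ℕₚ.n≤1+n _)))
     ; (there (there (there (there ())))) })
  (λ { (here refl) → there (here refl) ; (there (there (there (there ())))) })
BI-oriented (q _ l) = top (there (there (there (here refl))))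
  (λ { (here refl) → s≤s (ℕₚ.≤-trans l (ℕₚ.m≤n+m _ 3))
     ; (there (here refl)) → s≤s (s≤s (ℕₚ.≤-trans l (ℕₚ.m≤n+m _ 2)))
     ; (there (there (there (there ())))) })
  (λ { (here refl) → there (here refl) ; (there (there (there (there ())))) })

quad-⊆ : ∀ {a b c d : ℤ} {G} → a ∈ G → b ∈ G → c ∈ G → d ∈ G → a ∷ b ∷ c ∷ d ∷ [] ⊆ G
quad-⊆ a∈ b∈ c∈ d∈ = ∷-⊆ a∈ (∷-⊆ b∈ (∷-⊆ c∈ (∷-⊆ d∈ λ ())))

pattern 0th = here refl
pattern 1st = there (here refl)
pattern 2nd = there (there (here refl))
pattern 3rd = there (there (there (here refl)))
pattern 4th = there (there (there (there (here refl))))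

-- `InBI` collects the tetrahedra of all B(I), with i standing for n - 4 - i_j in `c` and `q`. Those
-- containing 3+i and 5+i are persistent facets; the others form part of B^{3,1}_n, with `a₂` and
-- `a₃` equal to `X₁` and `X₂` up to order.
BI-face : ∀ {j D F} → Stage j D → InBI j F → Face D F
BI-face st (p l) = face⊆ (quad-⊆ 2nd 3rd 1st 0th) (Stage.persistent st (pos (s≤s z≤n)) l)
BI-face st r = face⊆ (quad-⊆ 2nd 3rd 1st 0th) (Stage.ball⊂ st (join (pos (s≤s z≤n))))
BI-face st a₁ = face⊆ (quad-⊆ 3rd 2nd 1st 0th) (Stage.ball⊂ st (join mid))
BI-face st a₂ = face⊆ (quad-⊆ 2nd 3rd 1st 0th) (Stage.ball⊂ st x₁)
BI-face st a₃ = face⊆ (quad-⊆ 2nd 3rd 1st 0th) (Stage.ball⊂ st x₂)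
BI-face st (q₀ l) = face⊆ (quad-⊆ 2nd 3rd 1st 0th) (Stage.ball⊂ st (join (neg (s≤s l))))
BI-face st (c l) = face⊆ (quad-⊆ 3rd 2nd 1st 0th) (Stage.persistent st mid l)
BI-face st (q l l') = face⊆ (quad-⊆ 2nd 3rd 1st 0th) (Stage.persistent st (neg (s≤s l')) l)

-- Attaching the negative vertices of B(I) in order

module _ (j : ℕ) where
  -- Unfolds to the same expression as the private vertex function in `BI`, for n = 4 + j.
  ν : ℕ → ℤ
  ν m = (+ m) ℤ.- (+ (4 + j))

  ν-value : ∀ {m k} → m + suc k ≡ 4 + j → ν m ≡ -[1+ k ]
  ν-value {m} {k} e = trans (ℤₚ.m-n≡m⊖n m (4 + j)) (trans (ℤₚ.⊖-< m<n) (cong (λ x → ℤ.- (+ x)) n∸m))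
    where
    m<n : m < 4 + j
    m<n = subst (m <_) e (ℕₚ.m<m+n m (s≤s z≤n))
    n∸m : 4 + j ∸ m ≡ suc k
    n∸m = trans (cong (_∸ m) (sym e)) (ℕₚ.m+n∸m≡n m (suc k))

  -- the negative vertices of S are exactly -n, ..., -(n - lo)
  record State (lo : ℕ) (S : FacetList) : Set where
    field
      stacked : Stacked S
      entries : All (InBI j) S
      seen : ∀ {F k} → F ∈ S → -[1+ k ] ∈ F → 4 + j ≤ suc k + lo
      has : ∀ k → 4 + j ≤ suc k + lo → suc k ≤ 4 + j → Any (-[1+ k ] ∈_) S
      base : ∀ {i} → i < j → (+ 1 ∷ + 2 ∷ + (3 + i) ∷ + (5 + i) ∷ []) ∈ S
      base-root : (+ 1 ∷ + 2 ∷ + (3 + j) ∷ + (4 + j) ∷ []) ∈ S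

  state-add : ∀ {lo S F G k} → State lo S → InBI j F → suc lo + suc k ≡ 4 + j →
    -[1+ k ] ∈ F → G ∈ S → F ⊆ -[1+ k ] ∷ G → State (suc lo) (F ∷ S)
  state-add {lo} {S} {F} {G} {k} st inF e x∈ G∈ s = record
    { stacked = add (BI-tet inF) x∈ G∈ s (All.tabulate fresh') stacked
    ; entries = inF ∷ entries
    ; seen = seen'
    ; has = has'
    ; base = there ∘ base
    ; base-root = there base-root
    }
    where
    open State st
    n≡ : 4 + j ≡ suc (suc k + lo)
    n≡ = trans (sym e) (trans (cong suc (ℕₚ.+-suc lo k)) (cong (suc ∘ suc) (ℕₚ.+-comm lo k)))
    fresh' : ∀ {H} → H ∈ S → -[1+ k ] ∉ H
    fresh' H∈ x∈H = ℕₚ.<⇒≱ ℕₚ.≤-refl (ℕₚ.≤-trans (ℕₚ.≤-reflexive (sym n≡)) (seen H∈ x∈H))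
    weaken : ∀ {k'} → 4 + j ≤ suc k' + lo → 4 + j ≤ suc k' + suc lo
    weaken {k'} l = ℕₚ.≤-trans l (ℕₚ.+-monoʳ-≤ (suc k') (ℕₚ.n≤1+n lo))
    seen' : ∀ {H k'} → H ∈ F ∷ S → -[1+ k' ] ∈ H → 4 + j ≤ suc k' + suc lo
    seen' (there H∈) x∈' = weaken (seen H∈ x∈')
    seen' {k' = k'} (here refl) x∈' with s x∈'
    ... | here refl = ℕₚ.≤-reflexive (trans n≡ (sym (ℕₚ.+-suc (suc k) lo)))
    ... | there g = weaken (seen G∈ g)
    has' : ∀ k' → 4 + j ≤ suc k' + suc lo → suc k' ≤ 4 + j → Any (-[1+ k' ] ∈_) (F ∷ S)
    has' k' l l' with k' ℕ.≟ k
    ... | yes refl = here x∈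
    ... | no n = there (has k' (subst (_≤ suc k' + lo) (sym n≡)
        (ℕₚ.+-monoˡ-≤ lo (s≤s (ℕₚ.≤∧≢⇒< k≤k' (n ∘ sym))))) l')
      where
      k≤k' : k ≤ k'
      k≤k' = ℕₚ.+-cancelʳ-≤ lo k k' (ℕₚ.≤-pred (ℕₚ.≤-pred
        (subst₂ _≤_ n≡ (ℕₚ.+-suc (suc k') lo) l)))

  -- All tetrahedra of a run contain {u, w}. Each brings ν (m+1) and is glued along {ν m, u, w} to
  -- its predecessor, the first one to G. The latest negative vertex at the start is ν lo = -(K+2).
  -- `ʳ++` puts the last tetrahedron at the head, as `Stacked` expects.
  run : ∀ L {K lo S G u w} (f : ℕ → Simplex) →
    (∀ k → f k ≡ ν (lo + k + 1) ∷ ν (lo + k) ∷ u ∷ w ∷ []) →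
    State lo S → lo + (2 + K) ≡ 4 + j → L ≤ suc K →
    (∀ {k} → k ≤ K → InBI j (-[1+ k ] ∷ -[1+ suc k ] ∷ u ∷ w ∷ [])) →
    G ∈ S → -[1+ suc K ] ∈ G → u ∈ G → w ∈ G → State (lo + L) (applyUpTo f L ʳ++ S)
  run zero {lo = lo} {S} f _ st _ _ _ _ _ _ _ = subst (λ l → State l S) (sym (ℕₚ.+-identityʳ lo)) st
  run (suc L) {K} {lo} {S} {u = u} {w} f f≡ st e L≤ inBI G∈ y∈ u∈ w∈ =
    subst (λ l → State l (applyUpTo (f ∘ suc) L ʳ++ (f 0 ∷ S))) (sym (ℕₚ.+-suc lo L)) (next L K refl L≤)
    where
    f0 : f 0 ≡ -[1+ K ] ∷ -[1+ suc K ] ∷ u ∷ w ∷ []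
    f0 = trans (f≡ 0) (cong₂ (λ x y → x ∷ y ∷ u ∷ w ∷ [])
      (ν-value (trans (cong (λ m → m + 1 + suc K) (ℕₚ.+-identityʳ lo)) (trans (ℕₚ.+-assoc lo 1 (suc K)) e)))
      (ν-value (trans (cong (_+ (2 + K)) (ℕₚ.+-identityʳ lo)) e)))
    e' : suc lo + suc K ≡ 4 + j
    e' = trans (sym (ℕₚ.+-suc lo (suc K))) e
    st' : State (suc lo) (f 0 ∷ S)
    st' = subst (λ F → State (suc lo) (F ∷ S)) (sym f0)
      (state-add st (inBI ℕₚ.≤-refl) e' 0th G∈ (quad-⊆ 0th (there y∈) (there u∈) (there w∈)))
    in-f0 : ∀ {x} → x ∈ -[1+ K ] ∷ -[1+ suc K ] ∷ u ∷ w ∷ [] → x ∈ f 0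
    in-f0 {x} = subst (x ∈_) (sym f0)
    -- At the last tetrahedron `K` may be 0, so its predecessor is taken only if another tetrahedron
    -- follows.
    next : ∀ L' K' → K ≡ K' → suc L' ≤ suc K' → State (suc lo + L') (applyUpTo (f ∘ suc) L' ʳ++ (f 0 ∷ S))
    next zero K' _ _ = subst (λ l → State l (f 0 ∷ S)) (sym (ℕₚ.+-identityʳ (suc lo))) st'
    next L'@(suc _) (suc K') refl (s≤s l) = run L' {K = K'} (f ∘ suc)
      (λ k → trans (f≡ (suc k)) (cong (λ m → ν (m + 1) ∷ ν m ∷ u ∷ w ∷ []) (ℕₚ.+-suc lo k)))
      st' e' l (λ k≤ → inBI (ℕₚ.m≤n⇒m≤1+n k≤)) 0th (in-f0 0th) (in-f0 2nd) (in-f0 3rd)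

  -- The number is the current i_j and the list holds its successors up to i_{p+1} = n - 2. The
  -- witness i = n - 4 - i_j is the index in `c` and `q`.
  data Steps : ℕ → List ℕ → Set where
    last : Steps (2 + j) []
    step : ∀ {a i b l} → 1 ≤ a → a + i ≡ j → a < b → b ≤ 2 + j → Steps b l → Steps a (b ∷ l)

  -- For b = a + 1 the range is empty and the sum is still `suc b`.
  run-end : ∀ {a b} → a < b → a + 2 + (suc b ∸ (a + 2)) ≡ suc b
  run-end {a} {b} l = ℕₚ.m+[n∸m]≡n (subst (_≤ suc b) (ℕₚ.+-comm 2 a) (s≤s l))

  -- A block starts afresh from the positive part: `C` brings ν (a+2) and is glued to {1, 2, 3+i,
  -- 5+i} along {1, 3+i, 5+i}. The run after it continues up to ν (b+1), where the next block
  -- begins.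
  blocks-state : ∀ {a l S} → Steps a l → State (suc a) S → State (3 + j) (blocks (4 + j) (a ∷ l) ʳ++ S)
  blocks-state last st = st
  blocks-state {a} {b ∷ l} {S} (step {i = i} 1≤a refl a<b b≤ steps) st =
    subst (λ L → State (3 + j) L) (sym (Listₚ.++-ʳ++ (C ∷ Q)))
      (blocks-state steps (subst (λ l → State l ((C ∷ Q) ʳ++ S)) (run-end a<b)
        (subst (λ L → State (a + 2 + len) (L ʳ++ (C ∷ S))) (sym (Listₚ.map-applyUpTo _ g len)) runs)))
    where
    g : ℕ → Simplex
    g m = ν (m + 1) ∷ ν m ∷ + (4 + j ∸ a ∸ 1) ∷ + (4 + j ∸ a + 1) ∷ []
    len = suc b ∸ (a + 2)
    C = + 1 ∷ ν (a + 2) ∷ + (4 + j ∸ a ∸ 1) ∷ + (4 + j ∸ a + 1) ∷ []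
    Q = map g (range (a + 2) b)
    n∸a : 4 + j ∸ a ≡ 4 + i
    n∸a = trans (cong (_∸ a) (sym (trans (cong (λ x → a + x) (ℕₚ.+-comm 4 i)) (trans (sym (ℕₚ.+-assoc a i 4)) (ℕₚ.+-comm (a + i) 4)))))
      (ℕₚ.m+n∸m≡n a (4 + i))
    low : 4 + j ∸ a ∸ 1 ≡ 3 + i
    low = cong (_∸ 1) n∸a
    high : 4 + j ∸ a + 1 ≡ 5 + i
    high = trans (cong (_+ 1) n∸a) (ℕₚ.+-comm (4 + i) 1)
    a+ : ∀ m → a + (m + i) ≡ m + j
    a+ m = trans (sym (ℕₚ.+-assoc a m i)) (trans (cong (_+ i) (ℕₚ.+-comm a m)) (ℕₚ.+-assoc m a i))
    i<j : i < j
    i<j = ℕₚ.+-monoˡ-≤ i 1≤a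
    a+4 : a + 2 + (2 + i) ≡ 4 + j
    a+4 = trans (ℕₚ.+-assoc a 2 (2 + i)) (a+ 4)
    C≡ : C ≡ + 1 ∷ -[1+ suc i ] ∷ + (3 + i) ∷ + (5 + i) ∷ []
    C≡ = cong₂ (λ x τ → + 1 ∷ x ∷ τ) (ν-value a+4) (cong₂ (λ x y → + x ∷ + y ∷ []) low high)
    st₁ : State (a + 2) (C ∷ S)
    st₁ = subst₂ (λ l F → State l (F ∷ S)) (ℕₚ.+-comm 2 a) (sym C≡)
      (state-add st (c i<j) (trans (sym (trans (ℕₚ.+-assoc a 2 (2 + i)) (trans (ℕₚ.+-suc a (3 + i)) (cong suc (ℕₚ.+-suc a (2 + i)))))) a+4) 1st
        (State.base st i<j) (quad-⊆ 1st 0th 3rd 4th))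
    in-C : ∀ {x} → x ∈ + 1 ∷ -[1+ suc i ] ∷ + (3 + i) ∷ + (5 + i) ∷ [] → x ∈ C
    in-C {x} = subst (x ∈_) (sym C≡)
    len≤ : len ≤ suc i
    len≤ = ℕₚ.≤-trans (ℕₚ.∸-monoˡ-≤ (a + 2) (s≤s b≤))
      (ℕₚ.≤-reflexive (trans (cong (_∸ (a + 2)) (sym (trans (ℕₚ.+-assoc a 2 (suc i)) (a+ 3)))) (ℕₚ.m+n∸m≡n (a + 2) (suc i))))
    runs : State (a + 2 + len) (applyUpTo (λ k → g (a + 2 + k)) len ʳ++ (C ∷ S))
    runs = run len (λ k → g (a + 2 + k))
      (λ k → cong₂ (λ x y → ν (a + 2 + k + 1) ∷ ν (a + 2 + k) ∷ + x ∷ + y ∷ []) low high)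
      st₁ a+4 len≤ (q i<j) 0th (in-C 1st) (in-C 2nd) (in-C 3rd)

-- Assembling B(I), starting from the tetrahedra through {1, 2}

module _ (j : ℕ) where
  private
    P : ℕ → Simplex
    P i = + 1 ∷ + 2 ∷ + (3 + i) ∷ + (5 + i) ∷ []
    R : Simplex
    R = + 1 ∷ + 2 ∷ + (3 + j) ∷ + (4 + j) ∷ []

  -- The construction goes down from `R`: `P lo` brings 3+lo and is glued along {1, 2, 5+lo}, for
  -- which `has` supplies a tetrahedron. Hence the listing order of `BI` already has the latest
  -- tetrahedron first.
  record PositiveState (lo : ℕ) (S : FacetList) : Set where
    field
      stacked : Stacked S
      vertices : ∀ {F x} → F ∈ S → x ∈ F → ∃ λ k → x ≡ + k × (k ≤ 2 ⊎ 3 + lo ≤ k)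
      has : ∀ {v} → 3 + lo ≤ v → v ≤ 4 + j → ∃ λ G → G ∈ S × + 1 ∈ G × + 2 ∈ G × + v ∈ G

  positive-state : ∀ L lo f → (∀ k → f k ≡ P (lo + k)) → lo + L ≡ j →
    PositiveState lo (applyUpTo f L ++ [ R ])
  positive-state zero lo f _ e with trans (sym (ℕₚ.+-identityʳ lo)) e
  ... | refl = record
    { stacked = root (BI-tet (r {j}))
    ; vertices = λ where
        (here refl) 0th → _ , refl , inj₁ (s≤s z≤n)
        (here refl) 1st → _ , refl , inj₁ ℕₚ.≤-refl
        (here refl) 2nd → _ , refl , inj₂ ℕₚ.≤-refl
        (here refl) 3rd → _ , refl , inj₂ (ℕₚ.n≤1+n _)
    ; has = λ {v} l l' → R , here refl , 0th , 1st , end-vertex v l l'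
    }
    where
    end-vertex : ∀ v → 3 + j ≤ v → v ≤ 4 + j → + v ∈ R
    end-vertex v l l' with v ℕ.≟ 3 + j
    ... | yes refl = 2nd
    ... | no n with ℕₚ.≤-antisym l' (ℕₚ.≤∧≢⇒< l (n ∘ sym))
    ... | refl = 3rd
  positive-state (suc L) lo f f≡ e = subst (λ F → PositiveState lo (F ∷ S)) (sym f0) (record
    { stacked = add (BI-tet (p {j} lo<j)) 2nd G∈
        (quad-⊆ (there 1∈) (there 2∈) 0th (there y∈))
        (All.tabulate fresh') st.stacked
    ; vertices = vertices'
    ; has = has'
    })
    where
    S = applyUpTo (f ∘ suc) L ++ [ R ]
    f0 : f 0 ≡ P lo
    f0 = trans (f≡ 0) (cong P (ℕₚ.+-identityʳ lo))
    lo<j : lo < j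
    lo<j = subst (lo <_) e (ℕₚ.m<m+n lo (s≤s z≤n))
    module st = PositiveState (positive-state L (suc lo) (f ∘ suc)
      (λ k → trans (f≡ (suc k)) (cong P (ℕₚ.+-suc lo k))) (trans (sym (ℕₚ.+-suc lo L)) e))
    earlier = st.has {5 + lo} (ℕₚ.n≤1+n _) (s≤s (s≤s (s≤s (s≤s lo<j))))
    G∈ = proj₁ (proj₂ earlier)
    1∈ = proj₁ (proj₂ (proj₂ earlier))
    2∈ = proj₁ (proj₂ (proj₂ (proj₂ earlier)))
    y∈ = proj₂ (proj₂ (proj₂ (proj₂ earlier)))
    fresh' : ∀ {H} → H ∈ S → + (3 + lo) ∉ H
    fresh' H∈ x∈ with st.vertices H∈ x∈
    ... | _ , refl , inj₁ (s≤s (s≤s ()))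
    ... | _ , refl , inj₂ l = ℕₚ.<⇒≱ l ℕₚ.≤-refl
    vertices' : ∀ {F x} → F ∈ P lo ∷ S → x ∈ F → ∃ λ k → x ≡ + k × (k ≤ 2 ⊎ 3 + lo ≤ k)
    vertices' (here refl) 0th = _ , refl , inj₁ (s≤s z≤n)
    vertices' (here refl) 1st = _ , refl , inj₁ ℕₚ.≤-refl
    vertices' (here refl) 2nd = _ , refl , inj₂ ℕₚ.≤-refl
    vertices' (here refl) 3rd = _ , refl , inj₂ (ℕₚ.m≤n+m _ 2)
    vertices' (there F∈) x∈ with st.vertices F∈ x∈
    ... | k , e , inj₁ l = k , e , inj₁ l
    ... | k , e , inj₂ l = k , e , inj₂ (ℕₚ.≤-trans (ℕₚ.n≤1+n _) l)
    has' : ∀ {v} → 3 + lo ≤ v → v ≤ 4 + j → ∃ λ G → G ∈ P lo ∷ S × + 1 ∈ G × + 2 ∈ G × + v ∈ G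
    has' {v} l l' with v ℕ.≟ 3 + lo
    ... | yes refl = P lo , 0th , 0th , 1st , 2nd
    ... | no n with st.has (ℕₚ.≤∧≢⇒< l (n ∘ sym)) l'
    ... | G , G∈ , rest = G , there G∈ , rest

  private
    Pᵢ : ℕ → Simplex
    Pᵢ i = + 1 ∷ + 2 ∷ + i ∷ + (i + 2) ∷ []

    S₀ : FacetList
    S₀ = map Pᵢ (range 3 (2 + j)) ++ [ R ]

    P' : ℕ → Simplex
    P' k = + 1 ∷ + 2 ∷ + (3 + k) ∷ + (3 + k + 2) ∷ []

    S₀≡ : applyUpTo P' j ++ [ R ] ≡ S₀
    S₀≡ = cong (_++ [ R ]) (sym (Listₚ.map-applyUpTo (λ k → 3 + k) Pᵢ j))

    P≡ : ∀ k → P' k ≡ P k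
    P≡ k = cong (λ x → + 1 ∷ + 2 ∷ + (3 + k) ∷ + x ∷ []) (ℕₚ.+-comm (3 + k) 2)

    state₀ : PositiveState 0 S₀
    state₀ = subst (PositiveState 0) S₀≡ (positive-state j 0 _ P≡ refl)
    module S₀ = PositiveState state₀

    base₀ : ∀ {i} → i < j → P i ∈ S₀
    base₀ {i} l = subst₂ _∈_ (P≡ i) S₀≡ (∈-++⁺ˡ (∈-applyUpTo⁺ P' l))

    root₀ : R ∈ S₀
    root₀ = ∈-++⁺ʳ (map Pᵢ (range 3 (2 + j))) (here refl)

    entries₀ : All (InBI j) S₀
    entries₀ = subst (All (InBI j)) S₀≡ (All.tabulate entry)
      where
      entry : ∀ {F} → F ∈ applyUpTo P' j ++ [ R ] → InBI j F
      entry F∈ with ∈-++⁻ (applyUpTo P' j) F∈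
      ... | inj₂ (here refl) = r
      ... | inj₁ F∈' with ∈-applyUpTo⁻ P' F∈'
      ... | k , l , e = subst (InBI j) (sym (trans e (P≡ k))) (p l)

    A₁ A₂ A₃ : Simplex
    A₁ = + 1 ∷ -[1+ suc j ] ∷ + (3 + j) ∷ + (4 + j) ∷ []
    A₂ = + 1 ∷ -[1+ suc j ] ∷ -[1+ 2 + j ] ∷ + (4 + j) ∷ []
    A₃ = + 1 ∷ -[1+ suc j ] ∷ -[1+ 2 + j ] ∷ -[1+ 3 + j ] ∷ []

    -- `A₁`, glued to `R`, brings -(n-2); `A₂` then brings -(n-1) and `A₃` brings -n. These are the
    -- three negative vertices that `State` prescribes for lo = 2.
    state₁ : State j 2 (A₃ ∷ A₂ ∷ A₁ ∷ S₀)
    state₁ = record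
      { stacked =
          add (BI-tet (a₃ {j})) 3rd 0th (quad-⊆ 1st 2nd 3rd 0th)
            (none (λ ()) (λ ()) (λ ()) (λ ()) ∷ none (λ ()) (λ ()) (λ ()) (λ ()) ∷ positive₀)
          (add (BI-tet (a₂ {j})) 2nd 0th (quad-⊆ 1st 2nd 0th 4th)
            (none (λ ()) (λ ()) (λ ()) (λ ()) ∷ positive₀)
          (add (BI-tet (a₁ {j})) 1st root₀ (quad-⊆ 1st 0th 3rd 4th) positive₀ S₀.stacked))
      ; entries = a₃ ∷ a₂ ∷ a₁ ∷ entries₀
      ; seen = seen
      ; has = has
      ; base = λ l → there (there (there (base₀ l)))
      ; base-root = there (there (there root₀))
      }
      where
      positive₀ : ∀ {k} → All (-[1+ k ] ∉_) S₀
      positive₀ = All.tabulate λ F∈ x∈ → case S₀.vertices F∈ x∈ of λ { (_ , () , _) }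
      small : ∀ m → 4 + j ≤ 2 + m + j + 2
      small m = ℕₚ.≤-trans (ℕₚ.≤-reflexive (ℕₚ.+-comm 2 (2 + j)))
        (ℕₚ.+-monoˡ-≤ 2 (s≤s (s≤s (ℕₚ.m≤n+m j m))))
      seen : ∀ {F k} → F ∈ A₃ ∷ A₂ ∷ A₁ ∷ S₀ → -[1+ k ] ∈ F → 4 + j ≤ suc k + 2
      seen 0th 1st = small 0
      seen 0th 2nd = small 1
      seen 0th 3rd = small 2
      seen 1st 1st = small 0
      seen 1st 2nd = small 1
      seen 1st (there (there (there (there ()))))
      seen 2nd 1st = small 0
      seen 2nd (there (there (there (there ()))))
      seen (there (there (there F∈))) x∈ = ⊥-elim (All.lookup positive₀ F∈ x∈)
      has : ∀ k → 4 + j ≤ suc k + 2 → suc k ≤ 4 + j → Any (-[1+ k ] ∈_) (A₃ ∷ A₂ ∷ A₁ ∷ S₀)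
      has k l l' with k ℕ.≟ suc j | k ℕ.≟ 2 + j
      ... | yes refl | _ = here 1st
      ... | no _ | yes refl = here 2nd
      ... | no n | no m with ℕₚ.≤-antisym (ℕₚ.≤-pred l')
            (ℕₚ.≤∧≢⇒< (ℕₚ.≤∧≢⇒< (ℕₚ.≤-pred (ℕₚ.+-cancelʳ-≤ 2 (2 + j) (suc k)
              (subst (_≤ suc k + 2) (ℕₚ.+-comm 2 (2 + j)) l))) (n ∘ sym)) (m ∘ sym))
      ... | refl = here 3rd

    Q₀ : ℕ → Simplex
    Q₀ m = ν j (m + 1) ∷ ν j m ∷ + (3 + j) ∷ + (4 + j) ∷ []

    S₁ : FacetList
    S₁ = (+ 1 ∷ ν j 2 ∷ ν j 1 ∷ ℤ.- (+ (4 + j)) ∷ []) ∷ (+ 1 ∷ ν j 2 ∷ ν j 1 ∷ + (4 + j) ∷ []) ∷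
         (+ 1 ∷ ν j 2 ∷ + (3 + j) ∷ + (4 + j) ∷ []) ∷ S₀

    S₁≡ : A₃ ∷ A₂ ∷ A₁ ∷ S₀ ≡ S₁
    S₁≡ = cong₂ {C = FacetList} (λ x y → (+ 1 ∷ x ∷ y ∷ -[1+ 3 + j ] ∷ []) ∷ (+ 1 ∷ x ∷ y ∷ + (4 + j) ∷ []) ∷
        (+ 1 ∷ x ∷ + (3 + j) ∷ + (4 + j) ∷ []) ∷ S₀)
      (sym (ν-value j {2} refl)) (sym (ν-value j {1} refl))

    -- The first run starts at `A₁`, which contains -(n-2), n-1 and n.
    state₂ : ∀ {a} → 1 ≤ a → a ≤ 2 + j → State j (suc a) (map Q₀ (range 2 a) ʳ++ S₁)
    state₂ {suc a} _ l = subst₂ (λ L S → State j (2 + a) (L ʳ++ S)) (sym (Listₚ.map-applyUpTo (λ k → 2 + k) Q₀ a)) S₁≡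
      (run j a {K = j} (λ k → Q₀ (2 + k)) (λ _ → refl) state₁ refl (ℕₚ.≤-pred l) q₀ 2nd 1st 2nd 3rd)

  facets-rest : List ℕ → FacetList
  facets-rest I = (+ 1 ∷ ν j 2 ∷ + (3 + j) ∷ + (4 + j) ∷ []) ∷ (+ 1 ∷ ν j 2 ∷ ν j 1 ∷ + (4 + j) ∷ []) ∷
    (+ 1 ∷ ν j 2 ∷ ν j 1 ∷ ℤ.- (+ (4 + j)) ∷ []) ∷
    map Q₀ (range 2 (firstOr (2 + j) I)) ++ blocks (4 + j) (I ++ [ 2 + j ])

  -- Only `facets-rest` is reversed: it is listed in the order of attachment, while `S₀` has its
  -- latest tetrahedron first.
  stackedBI : List ℕ → FacetList
  stackedBI I = facets-rest I ʳ++ S₀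

  stackedBI↭ : ∀ I → stackedBI I ↭ BI (4 + j) I
  stackedBI↭ I = ↭-trans (Perm.↭-reflexive (Listₚ.ʳ++-defn (facets-rest I)))
    (↭-trans (Permₚ.++⁺ʳ S₀ (Permₚ.↭-reverse (facets-rest I)))
    (↭-trans (Permₚ.++-comm (facets-rest I) S₀)
      (Perm.↭-reflexive (Listₚ.++-assoc (map Pᵢ (range 3 (2 + j))) [ R ] (facets-rest I)))))

  final-state : ∀ {I a l} → I ++ [ 2 + j ] ≡ a ∷ l → firstOr (2 + j) I ≡ a → 1 ≤ a → a ≤ 2 + j → Steps j a l →
    State j (3 + j) (stackedBI I)
  final-state {I} e refl 1≤a a≤ steps =
    subst (State j (3 + j)) (sym (Listₚ.++-ʳ++ (map Q₀ (range 2 (firstOr (2 + j) I)))))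
      (subst (λ (l : List ℕ) → State j (3 + j) (blocks (4 + j) l ʳ++ (map Q₀ (range 2 (firstOr (2 + j) I)) ʳ++ S₁))) (sym e)
        (blocks-state j steps (state₂ 1≤a a≤)))

  state-cover : ∀ {S v} → State j (3 + j) S → InV (4 + j) v → Any (v ∈_) S
  state-cover st (suc k , _ , l , inj₂ refl) =
    State.has st k (s≤s (ℕₚ.m≤n+m (3 + j) k)) l
  state-cover st (1 , _ , _ , inj₁ refl) = lose (State.base-root st) 0th
  state-cover st (2 , _ , _ , inj₁ refl) = lose (State.base-root st) 1st
  state-cover st (suc (suc (suc i)) , _ , s≤s (s≤s (s≤s l)) , inj₁ refl) with i ℕ.≟ j | i ℕ.≟ suc j
  ... | yes refl | _ = lose (State.base-root st) 2nd
  ... | _ | yes refl = lose (State.base-root st) 3rd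
  ... | no n | no m = lose (State.base st (ℕₚ.≤∧≢⇒< (ℕₚ.≤-pred (ℕₚ.≤∧≢⇒< l m)) n)) 2nd

  -- The bound n - 6 equals j - 2 up to truncation, so a ≤ j and the witness in `step` is j - a.
  calI-steps : ∀ I → All (λ i → 3 ≤ i × i ≤ 4 + j ∸ 6) I → AllPairs _<_ I →
    ∃₂ λ a l → I ++ [ 2 + j ] ≡ a ∷ l × firstOr (2 + j) I ≡ a × 1 ≤ a × a ≤ 2 + j × Steps j a l
  calI-steps [] _ _ = 2 + j , [] , refl , refl , s≤s z≤n , ℕₚ.≤-refl , last
  calI-steps (a ∷ I) ((3≤a , a≤) ∷ bounds) (a< ∷ sorted) with calI-steps I bounds sorted
  ... | b , l , e , e' , _ , b≤ , steps =
    a , b ∷ l , cong (a ∷_) e , refl , 1≤a , ℕₚ.≤-trans a≤j (ℕₚ.m≤n+m j 2) ,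
    step 1≤a (ℕₚ.m+[n∸m]≡n a≤j) (subst (a <_) e' (a<first I a<)) b≤ steps
    where
    1≤a : 1 ≤ a
    1≤a = ℕₚ.≤-trans (s≤s z≤n) 3≤a
    a≤j : a ≤ j
    a≤j = ℕₚ.≤-trans a≤ (ℕₚ.m∸n≤m j 2)
    a<first : ∀ I → All (a <_) I → a < firstOr (2 + j) I
    a<first [] _ = s≤s (ℕₚ.≤-trans a≤j (ℕₚ.n≤1+n j))
    a<first (b ∷ _) (l ∷ _) = l

ΔI-Sphere : ∀ j I → InCalI (4 + j) I → Sphere (5 + j) (ΔI (4 + j) I)
ΔI-Sphere j I (bounds , sorted , _) with calI-steps j I bounds sorted
... | a , l , e , e' , 1≤a , a≤ , steps =
  Replacement.replaced (Stage.sphere st) (s≤s z≤n) (stackedBI↭ j I) (State.stacked final)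
    (BI-face st ∘ inBI) (λ F∈ G∈ → oriented-disjoint (BI-oriented (inBI F∈)) (BI-oriented (inBI G∈)))
    (Permₚ.Any-resp-↭ (stackedBI↭ j I) ∘ state-cover j final)
  where
  st = stage j
  final = final-state j e e' 1≤a a≤ steps
  inBI : ∀ {F} → F ∈ BI (4 + j) I → InBI j F
  inBI = All.lookup (Permₚ.All-resp-↭ (stackedBI↭ j I) (State.entries final))

InV-proper : ∀ {m v} → InV m v → v ≢ ℤ.- v
InV-proper (suc k , _ , _ , inj₁ refl) ()
InV-proper (suc k , _ , _ , inj₂ refl) ()

-- From edges to the vertex set and cs-2-neighborliness

module _ {m : ℕ} {K : FacetList} (sp : Sphere m K) (1≤m : 1 ≤ m) where
  sphere-vertices : VertexSetIs K m
  sphere-vertices v = mk⇔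
    (λ f → let τ , τ∈ , s = find f in Sphere.vertices sp τ∈ (s (here refl)))
    -- A vertex is obtained from the degenerate edge {v, v}, which is allowed because v differs from
    -- -v.
    (λ i → face⊆ (∷-⊆ (here refl) λ ()) (Sphere.edges sp i i (InV-proper i)))

  sphere-neighborly : CsNeighborly 2 m K
  sphere-neighborly [] _ _ _ _ = face⊆ (λ ()) (Equivalence.from (sphere-vertices (+ 1)) (1 , s≤s z≤n , 1≤m , inj₁ refl))
  sphere-neighborly (u ∷ []) _ (i ∷ _) _ _ = Equivalence.from (sphere-vertices u) i
  sphere-neighborly (u ∷ v ∷ []) _ (i ∷ i' ∷ _) _ proper =
    Sphere.edges sp i i' λ e → proper v (there (here refl)) (here (sym e))
  sphere-neighborly (u ∷ v ∷ w ∷ σ) _ _ (s≤s (s≤s ())) _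

theorem7p6 : (n : ℕ) → 10 ≤ n → (I : List ℕ) → InCalI n I →
    CombinatorialSphere 3 (ΔI n I) × CentrallySymmetric (ΔI n I) ×
    VertexSetIs (ΔI n I) (suc n) × CsNeighborly 2 (suc n) (ΔI n I)
theorem7p6 (suc (suc (suc (suc j)))) _ I inI =
  Sphere.sphere sp , Sphere.symmetric sp , sphere-vertices sp (s≤s z≤n) , sphere-neighborly sp (s≤s z≤n)
  where
  sp : Sphere (5 + j) (ΔI (4 + j) I)
  sp = ΔI-Sphere j I inI
theorem7p6 1 (s≤s ())
theorem7p6 2 (s≤s (s≤s ()))
theorem7p6 3 (s≤s (s≤s (s≤s ())))
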